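{- Let $G$ be a finite group and let $\mathfrak{X}(G)=(G,\{c_g\mid g\in G\})$ be the thin homogeneous coherent configuration defined by $G$. Then there exist natural bijections between the following sets: (1) the set of $\sim$ equivalence classes of weights on $\mathfrak{X}(G)$; (2) the set of $\sim_H$ equivalence classes of H-weights on $\mathfrak{X}(G)$; (3) $\bigcup_{H}H^2(H,\mathbb{C}^\times)$, where $H$ runs over all subgroups of $G$.
   Context: Let $G$ be a finite group and $M_G(\mathbb{C})$ the algebra of complex matrices with rows and columns indexed by $G$. For $g\in G$ put $c_g=\{(x,y)\in G\times G\mid xg=y\}$, and let $C=\{c_g\mid g\in G\}$ and $\mathfrak{X}(G)=(G,C)$. For $c\in C$ let $c^*=\{(y,x)\mid (x,y)\in c\}$, so $c_g^*=c_{g^{ -1}}$. Let $A_g\in M_G(\mathbb{C})$ be the $0/1$ matrix with $(A_g)_{x,y}=1$ if and only if $(x,y)\in c_g$. For $W\in M_G(\mathbb{C})$ let $\mathrm{spt}(W)=\{(x,y)\mid W_{xy}\neq 0\}$ and $A_g^W=A_g\circ W$ (entrywise product). For $a_x\in\mathbb{C}$ ($x\in G$), $\mathrm{diag}(a_x\mid x\in G)\in M_G(\mathbb{C})$ is the diagonal matrix with $(x,x)$-entry $a_x$. A matrix $W\in M_G(\mathbb{C})$ is a weight on $\mathfrak{X}(G)$ if: (W1) $\mathrm{spt}(W)$ is a union of members of $C$, and for $d\in C$, $d\subset\mathrm{spt}(W)$ implies $d^*\subset\mathrm{spt}(W)$; (W2) $W_{xx}\neq 0$ for all $x\in G$; (W3)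 $\bigoplus_{g\in G}\mathbb{C}A_g^W$ (the linear span of the $A_g^W$) is an algebra under matrix multiplication. It is an H-weight if moreover (W4) $W$ is hermitian, $|W_{xy}|\in\{0,1\}$ for all $x,y\in G$, and $W_{xx}=1$ for all $x\in G$. Equivalence: let $\mathrm{Aut}(\mathfrak{X}(G))$ be the group of permutations $\sigma$ of the set $G$ with $c^\sigma=c$ for all $c\in C$, where $c^\sigma=\{(x^\sigma,y^\sigma)\mid(x,y)\in c\}$, and let $P_\sigma$ be the permutation matrix corresponding to $\sigma$. Weights $W,W'$ are equivalent, written $W\sim W'$, if there exist $a_x\in\mathbb{C}^\times$ ($x\in G$), $\gamma(g)\in\mathbb{C}^\times$ ($g\in G$) and $\sigma\in\mathrm{Aut}(\mathfrak{X}(G))$ with $$W'=\mathrm{diag}(a_x\mid x\in G)^{ -1}P_\sigma^{ -1}\Big(\sum_{g\in G}\gamma(g)A_g^W\Big)P_\sigma\,\mathrm{diag}(a_x\mid x\in G).$$ H-weights $W,W'$ are H-equivalent, written $W\sim_H W'$, if this holds with $|a_x|=|\gamma(g)|=1$ for all $x,g\in G$ and $\gamma(g^{ -1})=\gamma(g)^{ -1}$ for all $g\in G$. For a finite group $H$, a factor set ($2$-cocycle) is a function $\alpha:H\times H\to\mathbb{C}^\times$ with $\alpha(g,h)\alpha(gh,k)=\alpha(g,hk)\alpha(h,k)$ for all $g,h,k\in H$ (trivial action of $H$ on $\mathbb{C}^\times$). The factor sets form an abelian group $Z^2(H,\mathbb{C}^\times)$ under pointwise multiplication; the $2$-coboundaries,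 i.e. the functions $(g,h)\mapsto\gamma(g)\gamma(h)\gamma(gh)^{ -1}$ for maps $\gamma:H\to\mathbb{C}^\times$, form a subgroup $B^2(H,\mathbb{C}^\times)$; and $H^2(H,\mathbb{C}^\times)=Z^2(H,\mathbb{C}^\times)/B^2(H,\mathbb{C}^\times)$ is the $2$-cohomology group of $H$. -}

module Defs where

open import Algebra.Bundles using (CommutativeRing; Group)
open import Algebra.Bundles.Raw using (RawMonoid)
open import Algebra.Structures using (IsGroup)
import Algebra.Definitions.RawMonoid as RawMonoidSum
import Algebra.Morphism.GroupMonomorphism as GroupMonomorphism
open import Data.Bool.Base using (if_then_else_)
open import Data.Fin.Base using (Fin)
import Data.Fin.Properties as Fin
open import Data.Nat.Base using (ℕ)
open import Data.Product.Base using (Σ; ∃; ∃-syntax; _×_; _,_; proj₁; proj₂)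
open import Data.Sum.Base using (_⊎_)
open import Function.Base using (_∘_; flip)
open import Function.Bundles using (_↔_; module Inverse)
import Function.Bundles as Fun
open import Function.Properties.Inverse using (↔-sym; Inverse⇒Injection)
open import Level using (0ℓ; suc)
open import Relation.Binary.Core using (Rel; _⇒_; _⇔_)
open import Relation.Binary.Definitions using (DecidableEquality)
open import Relation.Binary.PropositionalEquality using (_≡_; refl)
open import Relation.Binary.Structures using (IsTotalOrder)
open import Relation.Nullary.Decidable using (does; via-injection)
open import Relation.Nullary.Negation using (¬_)
open import Relation.Unary using (Pred; _∈_; _⊆_; _≐_)

-- The real numbers are given axiomatically, as a Dedekind-complete totally
-- ordered field; classically this determines them up to unique isomorphism.
-- Equality is a setoid equality, so that constructions of ℝ by Cauchy
-- sequences or Dedekind cuts are models.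
record CompleteOrderedField : Set (suc 0ℓ) where
  field
    commutativeRing : CommutativeRing 0ℓ 0ℓ

  open CommutativeRing commutativeRing public renaming (Carrier to ℝ)

  infix 4 _≤_

  field
    _≤_          : Rel ℝ 0ℓ
    isTotalOrder : IsTotalOrder _≈_ _≤_
    +-monoˡ-≤    : ∀ z {x y} → x ≤ y → x + z ≤ y + z
    *-nonNeg     : ∀ {x y} → 0# ≤ x → 0# ≤ y → 0# ≤ x * y
    0≉1          : ¬ (0# ≈ 1#)
    invertible   : ∀ x → ¬ (x ≈ 0#) → ∃[ y ] x * y ≈ 1#

  IsUpperBound : Pred ℝ 0ℓ → ℝ → Set
  IsUpperBound S b = ∀ x → x ∈ S → x ≤ b

  IsSupremum : Pred ℝ 0ℓ → ℝ → Set
  IsSupremum S s = IsUpperBound S s × (∀ b → IsUpperBound S b → s ≤ b)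

  field
    complete : (S : Pred ℝ 0ℓ) → ∃ S → ∃ (IsUpperBound S) → ∃ (IsSupremum S)

module Complex (R : CompleteOrderedField) where

  private module R = CompleteOrderedField R
  open R using (ℝ)

  record ℂ : Set where
    constructor _+i_
    field
      re im : ℝ

  open ℂ public

  infixl 7 _*_
  infixl 6 _+_
  infix  4 _≈_ ∣_∣≈_

  _≈_ : Rel ℂ 0ℓ
  z ≈ w = (re z R.≈ re w) × (im z R.≈ im w)

  0# 1# : ℂ
  0# = R.0# +i R.0#
  1# = R.1# +i R.0#

  conj : ℂ → ℂ
  conj z = re z +i (R.- im z)

  _+_ _*_ : ℂ → ℂ → ℂ
  z + w = (re z R.+ re w) +i (im z R.+ im w)
  z * w = (re z R.* re w R.- im z R.* im w) +i (re z R.* im w R.+ im z R.* re w)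

  -- |z| = r, i.e. r is the nonnegative square root of re² + im².
  ∣_∣≈_ : ℂ → ℝ → Set
  ∣ z ∣≈ r = (R.0# R.≤ r) × (r R.* r R.≈ re z R.* re z R.+ im z R.* im z)

  record ℂˣ : Set where
    field
      value    : ℂ
      inv      : ℂ
      inverseʳ : value * inv ≈ 1#

  open ℂˣ public using (value; inv)

  +-rawMonoid : RawMonoid 0ℓ 0ℓ
  +-rawMonoid = record { Carrier = ℂ ; _≈_ = _≈_ ; _∙_ = _+_ ; ε = 0# }

  open RawMonoidSum +-rawMonoid public using (sum)

module Cohomology (R : CompleteOrderedField) where

  open Complex R

  record FactorSet (H : Group 0ℓ 0ℓ) : Set where
    private module H = Group H
    field
      α       : H.Carrier → H.Carrier → ℂˣ
      α-cong  : ∀ {g g′ h h′} → g H.≈ g′ → h H.≈ h′ →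
                value (α g h) ≈ value (α g′ h′)
      cocycle : ∀ g h k →
                value (α g h) * value (α (g H.∙ h) k) ≈
                value (α g (h H.∙ k)) * value (α h k)

  IsCoboundary : (H : Group 0ℓ 0ℓ) (let module H = Group H) →
                 (H.Carrier → H.Carrier → ℂ) → Set
  IsCoboundary H f =
    Σ (H.Carrier → ℂˣ) λ γ →
      (∀ {g h} → g H.≈ h → value (γ g) ≈ value (γ h)) ×
      (∀ g h → f g h ≈ value (γ g) * value (γ h) * inv (γ (g H.∙ h)))
    where module H = Group H

  -- Equality in H²(H,ℂˣ) = Z²(H,ℂˣ)/B²(H,ℂˣ).
  Cohomologous : (H : Group 0ℓ 0ℓ) → Rel (FactorSet H) 0ℓ
  Cohomologous H a b =
    IsCoboundary H (λ g h → value (α a g h) * inv (α b g h))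
    where open FactorSet

record FiniteGroup : Set (suc 0ℓ) where
  infixl 7 _∙_
  infix  8 _⁻¹
  field
    Carrier     : Set
    _∙_         : Carrier → Carrier → Carrier
    ε           : Carrier
    _⁻¹         : Carrier → Carrier
    isGroup     : IsGroup _≡_ _∙_ ε _⁻¹
    order       : ℕ
    enumeration : Fin order ↔ Carrier

  infix 4 _≟_
  _≟_ : DecidableEquality Carrier
  _≟_ = via-injection (Inverse⇒Injection (↔-sym enumeration)) Fin._≟_

  group : Group 0ℓ 0ℓ
  group = record { isGroup = isGroup }

  record Subgroup : Set (suc 0ℓ) where
    field
      member    : Pred Carrier 0ℓ
      ε-closed  : ε ∈ member
      ∙-closed  : ∀ {g h} → g ∈ member → h ∈ member → g ∙ h ∈ member
      ⁻¹-closed : ∀ {g} → g ∈ member → g ⁻¹ ∈ member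

  -- Elements of a subgroup are compared by their underlying group element,
  -- ignoring the membership proof.
  ⟦_⟧ : Subgroup → Group 0ℓ 0ℓ
  ⟦ H ⟧ = record
    { Carrier = Σ Carrier member
    ; _≈_     = λ g h → proj₁ g ≡ proj₁ h
    ; _∙_     = λ (g , p) (h , q) → g ∙ h , ∙-closed p q
    ; ε       = ε , ε-closed
    ; _⁻¹     = λ (g , p) → g ⁻¹ , ⁻¹-closed p
    ; isGroup = GroupMonomorphism.isGroup
        {G₂ = Group.rawGroup group}
        {⟦_⟧ = proj₁}
        (record
          { isGroupHomomorphism = record
              { isMonoidHomomorphism = record
                  { isMagmaHomomorphism = record
                      { isRelHomomorphism = record { cong = λ p → p }
                      ; homo = λ _ _ → refl
                      }
                  ; ε-homo = refl
                  }
              ; ⁻¹-homo = λ _ → refl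
              }
          ; injective = λ p → p
          })
        isGroup
    }
    where open Subgroup H

module Weights (R : CompleteOrderedField) (𝔾 : FiniteGroup) where

  open CompleteOrderedField R using () renaming (0# to 0ℝ; 1# to 1ℝ)
  open Complex R
  open Cohomology R
  open FiniteGroup 𝔾 renaming (Carrier to G)

  ∑ : (G → ℂ) → ℂ
  ∑ f = sum (f ∘ Inverse.to enumeration)

  Matrix : Set
  Matrix = G → G → ℂ

  infix  4 _≋_
  infixl 7 _⊛_ _⊙_
  infixr 8 _•_

  _≋_ : Rel Matrix 0ℓ
  M ≋ N = ∀ x y → M x y ≈ N x y

  _⊛_ _⊙_ : Matrix → Matrix → Matrix
  (M ⊛ N) x y = ∑ λ z → M x z * N z y
  (M ⊙ N) x y = M x y * N x y

  _•_ : ℂ → Matrix → Matrix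
  (z • M) x y = z * M x y

  linComb : (G → ℂ) → (G → Matrix) → Matrix
  linComb k M x y = ∑ λ g → (k g • M g) x y

  diag : (G → ℂ) → Matrix
  diag a x y = if does (x ≟ y) then a x else 0#

  permMatrix : (G → G) → Matrix
  permMatrix f x y = if does (f x ≟ y) then 1# else 0#

  c : G → Rel G 0ℓ
  c g x y = x ∙ g ≡ y

  A : G → Matrix
  A g x y = if does (x ∙ g ≟ y) then 1# else 0#

  spt : Matrix → Rel G 0ℓ
  spt W x y = ¬ (W x y ≈ 0#)

  A[_] : Matrix → G → Matrix
  A[ W ] g = A g ⊙ W

  InSpan : Matrix → Pred Matrix 0ℓ
  InSpan W M = Σ (G → ℂ) λ k → M ≋ linComb k A[ W ]

  record IsWeight (W : Matrix) : Set (suc 0ℓ) where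
    field
      W1-union : Σ (Pred G 0ℓ) λ S →
                 spt W ⇔ (λ x y → ∃[ g ] g ∈ S × c g x y)
      W1-sym   : ∀ g → c g ⇒ spt W → flip (c g) ⇒ spt W
      W2       : ∀ x → ¬ (W x x ≈ 0#)
      -- The span is a linear subspace, so being an algebra amounts to closure
      -- under multiplication.  It then contains the identity: by W2 and
      -- closure, A[ W ] ε is a nonzero scalar matrix.
      W3       : ∀ M N → InSpan W M → InSpan W N → InSpan W (M ⊛ N)

  record IsHWeight (W : Matrix) : Set (suc 0ℓ) where
    field
      isWeight  : IsWeight W
      hermitian : ∀ x y → W y x ≈ conj (W x y)
      modulus   : ∀ x y → (∣ W x y ∣≈ 0ℝ) ⊎ (∣ W x y ∣≈ 1ℝ)
      unital    : ∀ x → W x x ≈ 1#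

  Weight HWeight : Set (suc 0ℓ)
  Weight  = Σ Matrix IsWeight
  HWeight = Σ Matrix IsHWeight

  toWeight : HWeight → Weight
  toWeight (W , isH) = W , IsHWeight.isWeight isH

  _^_ : Rel G 0ℓ → (G → G) → Rel G 0ℓ
  (r ^ f) u v = ∃[ x ] ∃[ y ] r x y × f x ≡ u × f y ≡ v

  record Aut : Set where
    field
      σ         : G ↔ G
      preserves : ∀ g → (c g ^ Inverse.to σ) ⇔ c g

    -- The inverse of a permutation matrix is that of the inverse permutation.
    P P⁻¹ : Matrix
    P   = permMatrix (Inverse.to σ)
    P⁻¹ = permMatrix (Inverse.from σ)

  transform : (a γ : G → ℂˣ) → Aut → Matrix → Matrix
  transform a γ s W =
    diag (inv ∘ a) ⊛ P⁻¹ ⊛ linComb (value ∘ γ) A[ W ] ⊛ P ⊛ diag (value ∘ a)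
    where open Aut s

  _∼_ : Rel Weight 0ℓ
  (W , _) ∼ (W′ , _) =
    Σ (G → ℂˣ) λ a → Σ (G → ℂˣ) λ γ → Σ Aut λ s → W′ ≋ transform a γ s W

  _∼ᴴ_ : Rel HWeight 0ℓ
  (W , _) ∼ᴴ (W′ , _) =
    Σ (G → ℂˣ) λ a → Σ (G → ℂˣ) λ γ → Σ Aut λ s →
      W′ ≋ transform a γ s W ×
      (∀ x → ∣ value (a x) ∣≈ 1ℝ) ×
      (∀ g → ∣ value (γ g) ∣≈ 1ℝ) ×
      (∀ g → value (γ (g ⁻¹)) ≈ inv (γ g))

  open Subgroup using (member)

  restrict : (H K : Subgroup) → member H ⊆ member K →
             FactorSet ⟦ K ⟧ → FactorSet ⟦ H ⟧
  restrict H K H⊆K a = record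
    { α       = λ g h → α (ι g) (ι h)
    ; α-cong  = α-cong
    ; cocycle = λ g h k →
        ≈-trans (*-congˡ (α-cong refl refl))
          (≈-trans (cocycle (ι g) (ι h) (ι k)) (*-congʳ (α-cong refl refl)))
    }
    where
    open FactorSet a
    module R = CompleteOrderedField R

    ι : Group.Carrier ⟦ H ⟧ → Group.Carrier ⟦ K ⟧
    ι (g , p) = g , H⊆K p

    ≈-trans : ∀ {u v w} → u ≈ v → v ≈ w → u ≈ w
    ≈-trans (p , q) (p′ , q′) = R.trans p p′ , R.trans q q′

    *-congˡ : ∀ {z u v} → u ≈ v → z * u ≈ z * v
    *-congˡ (p , q) =
      R.+-cong (R.*-congˡ p) (R.-‿cong (R.*-congˡ q)) ,
      R.+-cong (R.*-congˡ q) (R.*-congˡ p)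

    *-congʳ : ∀ {z u v} → u ≈ v → u * z ≈ v * z
    *-congʳ (p , q) =
      R.+-cong (R.*-congʳ p) (R.-‿cong (R.*-congʳ q)) ,
      R.+-cong (R.*-congʳ p) (R.*-congʳ q)

  -- Representatives of the elements of ⋃_H H²(H,ℂˣ).  The union is disjoint:
  -- two representatives are equal when their subgroups have the same elements
  -- and their factor sets are cohomologous.
  ⋃H² : Set (suc 0ℓ)
  ⋃H² = Σ Subgroup λ H → FactorSet ⟦ H ⟧

  _≈ᴴ²_ : Rel ⋃H² 0ℓ
  (H , a) ≈ᴴ² (K , b) =
    Σ (member H ≐ member K) λ (H⊆K , _) →
      Cohomologous ⟦ H ⟧ a (restrict H K H⊆K b)

  -- H = { g | c_g ⊂ spt(W) }, and the A_h^W (h ∈ H) multiply with structure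
  -- constants α.
  IsFactorSetOf : Weight → ⋃H² → Set
  IsFactorSetOf (W , _) (H , a) =
    (∀ g → (g ∈ member H) Fun.⇔ (c g ⇒ spt W)) ×
    (∀ (g h : Σ G (member H)) →
      A[ W ] (proj₁ g) ⊛ A[ W ] (proj₁ h) ≋
      value (α g h) • A[ W ] (proj₁ g ∙ proj₁ h))
    where open FactorSet a

{-# OPTIONS --safe #-}
-- Automorphisms of 𝔛(G) are left translations, so W ∼ W′ means
-- W′(x,y) = a(x)⁻¹ γ(x⁻¹y) W(tx,ty) a(y).  For a weight W the elements h with
-- c_h ⊂ spt(W) form a subgroup H, and (W3) says exactly that
-- W(x,y) W(y,z) = α(x⁻¹y, y⁻¹z) W(x,z) for x, y, z in one left coset of H, with
-- α a factor set of H.  Rescaling by γ changes α by its coboundary.  Conversely,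
-- if W and W′ have the same α, then W′/W is multiplicative along each coset, so
-- it is a(y)/a(x) where a(x) is its value between a coset representative and x;
-- and every α comes from W(x,y) = α(p⁻¹x, x⁻¹y), p the representative of xH.
--
-- For the H-versions, ℂˣ modulo the unit circle is uniquely divisible, so its
-- first and second cohomology vanish: a coboundary between unimodular factor
-- sets is that of a unimodular γ, and every class has a unimodular factor set.
-- Dividing by square roots of α(g,g⁻¹) then makes α(g,g⁻¹) = 1, which is
-- hermiticity of the weight constructed from α.
module Submission where

-- An automorphism preserves every `c_g`, so `σ(x g) = σ(x) g`, and it fixes all quotients `x⁻¹y`,
-- on which alone `α` depends. Translations thus act trivially on the invariant: conjugate subgroups
-- are not identified, and the union in (3) is over subgroups rather than conjugacy classes.
-- Everything is compared through the class in (3): equivalent weights have the same class, equal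
-- classes give an explicit transformation with the identity automorphism, and every class contains
-- an H-weight. The three bijections, and even the fact that both relations are equivalences, follow
-- formally. For H-weights hermiticity and modulus 1 force `α(g, g⁻¹) = 1`, and any `γ` on `H`
-- relating two such factor sets is automatically unimodular with `γ(g⁻¹) = γ(g)⁻¹`; no correction
-- of `γ` is required. Unique divisibility rests on n-th roots of positive reals, obtained from
-- suprema, and the vanishing of cohomology on averages over `H`, taken as sums over `G` because
-- only `G` comes with an enumeration.

open import Algebra.Bundles using (AbelianGroup; CommutativeMonoid; CommutativeRing; Group)
open import Algebra.Definitions.RawMonoid using () renaming (_×_ to multiple)
import Algebra.Properties.AbelianGroup as AbelianGroupProperties
import Algebra.Properties.CommutativeMonoid.Mult as CommutativeMonoidMult
import Algebra.Properties.CommutativeMonoid.Sum as CommutativeMonoidSum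
import Algebra.Properties.CommutativeSemigroup as CommutativeSemigroupProperties
import Algebra.Properties.CommutativeSemiring.Exp as CommutativeSemiringExp
import Algebra.Properties.Group as GroupProperties
import Algebra.Properties.Semiring.Exp as SemiringExp
import Algebra.Properties.Semiring.Sum as SemiringSum
import Algebra.Solver.CommutativeMonoid.Normal as CommutativeMonoidNormal
import Algebra.Solver.Ring.NaturalCoefficients.Default as SemiringSolver
open import Algebra.Structures using (IsAbelianGroup; IsCommutativeRing)
open import Axiom.ExcludedMiddle using (ExcludedMiddle)
open import Data.Bool.Base using (if_then_else_)
open import Data.Fin.Base using (Fin; zero; suc)
import Data.Fin.Properties as Fin
open import Data.List.Base using (List; []; _∷_)
open import Data.Nat.Base using (ℕ; zero; suc; NonZero)
open import Data.Product.Base using (∃-syntax; _×_; _,_; proj₁; proj₂; Σ-syntax; Σ)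
open import Data.Sum.Base using (inj₁; inj₂; _⊎_)
open import Data.Vec.Base using (Vec; []; _∷_; lookup; map; allFin)
open import Data.Vec.N-ary using (N-ary; _$ⁿ_)
open import Defs
open import Function.Base using (_∘_)
open import Function.Bundles using (_↔_; mk↔ₛ′; module Inverse; mk⇔; _⇔_)
open import Function.Construct.Composition using (_↔-∘_)
open import Function.Properties.Inverse using (↔-sym)
open import Function.Structures using (IsBijection; IsCongruent)
open import Level using (0ℓ)
open import Relation.Binary.Core using (Rel; _⇒_)
open import Relation.Binary.PropositionalEquality as ≡ using (_≡_; _≢_; cong; subst; cong₂)
import Relation.Binary.Reasoning.Setoid as SetoidReasoning
open import Relation.Binary.Structures using (IsTotalOrder; IsEquivalence)
open import Relation.Nullary.Decidable using (yes; no; decidable-stable; Dec; does; dec-true; dec-false)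
open import Relation.Nullary.Negation using (¬_; contradiction)
open import Relation.Unary using (Pred; _∈_; _⊆_; _∉_)

-- Decision procedures for commutative rings and abelian groups.

-- An expression e with negations is decided by the semiring solver after
-- writing it as a formal difference: e + neg e ≈ pos e.
module RingSolver (R : CommutativeRing 0ℓ 0ℓ) where
  open CommutativeRing R
  open AbelianGroupProperties +-abelianGroup using (∙-cancelʳ)
  open CommutativeSemigroupProperties +-commutativeSemigroup using (interchange; xy∙z≈xz∙y)
  open SemiringSolver commutativeSemiring
    using (Polynomial; con; var; _:+_; _:*_; _:=_; ⟦_⟧↓; solve; prove)
    renaming (⟦_⟧ to ⟦_⟧ₛ)
  open SetoidReasoning setoid

  infixl 6 _⊕_ _⊖_
  infixl 7 _⊗_
  infix  8 ⊝_
  infix  4 _⊜_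

  data Expr (n : ℕ) : Set where
    ′_      : Fin n → Expr n
    _⊕_ _⊗_ : Expr n → Expr n → Expr n
    ⊝_      : Expr n → Expr n
    #0 #1   : Expr n

  _⊖_ : ∀ {n} → Expr n → Expr n → Expr n
  d ⊖ e = d ⊕ ⊝ e

  _⊜_ : ∀ {n} → Expr n → Expr n → Expr n × Expr n
  _⊜_ = _,_

  private variable
    n : ℕ

  ⟦_⟧ : Expr n → Vec Carrier n → Carrier
  ⟦ ′ i ⟧ ρ   = lookup ρ i
  ⟦ d ⊕ e ⟧ ρ = ⟦ d ⟧ ρ + ⟦ e ⟧ ρ
  ⟦ d ⊗ e ⟧ ρ = ⟦ d ⟧ ρ * ⟦ e ⟧ ρ
  ⟦ ⊝ e ⟧ ρ   = - ⟦ e ⟧ ρ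
  ⟦ #0 ⟧ ρ    = 0#
  ⟦ #1 ⟧ ρ    = 1#

  pos neg : Expr n → Polynomial n
  pos (′ i)   = var i
  pos (d ⊕ e) = pos d :+ pos e
  pos (d ⊗ e) = pos d :* pos e :+ neg d :* neg e
  pos (⊝ e)   = neg e
  pos #0      = con 0
  pos #1      = con 1
  neg (′ i)   = con 0
  neg (d ⊕ e) = neg d :+ neg e
  neg (d ⊗ e) = pos d :* neg e :+ neg d :* pos e
  neg (⊝ e)   = pos e
  neg #0      = con 0
  neg #1      = con 0

  +neg : ∀ (e : Expr n) ρ → ⟦ e ⟧ ρ + ⟦ neg e ⟧ₛ ρ ≈ ⟦ pos e ⟧ₛ ρ
  +neg (′ i) ρ   = +-identityʳ _
  +neg (d ⊕ e) ρ = trans (interchange _ _ _ _) (+-cong (+neg d ρ) (+neg e ρ))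
  +neg (d ⊗ e) ρ = begin
    d′ * e′ + (⟦ pos d ⟧ₛ ρ * n′ + m * ⟦ pos e ⟧ₛ ρ)
      ≈⟨ +-congˡ (+-cong (*-congʳ (+neg d ρ)) (*-congˡ (+neg e ρ))) ⟨
    d′ * e′ + ((d′ + m) * n′ + m * (e′ + n′))
      ≈⟨ solve 4 (λ d m e n′ → d :* e :+ ((d :+ m) :* n′ :+ m :* (e :+ n′))
                   := (d :+ m) :* (e :+ n′) :+ m :* n′) refl d′ m e′ n′ ⟩
    (d′ + m) * (e′ + n′) + m * n′
      ≈⟨ +-congʳ (*-cong (+neg d ρ) (+neg e ρ)) ⟩
    ⟦ pos d ⟧ₛ ρ * ⟦ pos e ⟧ₛ ρ + m * n′ ∎
    where
    d′ = ⟦ d ⟧ ρ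
    e′ = ⟦ e ⟧ ρ
    m  = ⟦ neg d ⟧ₛ ρ
    n′ = ⟦ neg e ⟧ₛ ρ
  +neg (⊝ e) ρ = begin
    - ⟦ e ⟧ ρ + ⟦ pos e ⟧ₛ ρ               ≈⟨ +-congˡ (+neg e ρ) ⟨
    - ⟦ e ⟧ ρ + (⟦ e ⟧ ρ + ⟦ neg e ⟧ₛ ρ)   ≈⟨ +-assoc _ _ _ ⟨
    - ⟦ e ⟧ ρ + ⟦ e ⟧ ρ + ⟦ neg e ⟧ₛ ρ     ≈⟨ +-congʳ (-‿inverseˡ _) ⟩
    0# + ⟦ neg e ⟧ₛ ρ                      ≈⟨ +-identityˡ _ ⟩
    ⟦ neg e ⟧ₛ ρ                           ∎
  +neg #0 ρ = +-identityʳ _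
  +neg #1 ρ = +-identityʳ _

  close : ∀ n → N-ary n (Expr n) (Expr n × Expr n) → Expr n × Expr n
  close n f = f $ⁿ map ′_ (allFin n)

  -- Since each side plus its negative part is its positive part, adding both negative parts turns
  -- the goal into an identity without negation.
  byRing : ∀ n (f : N-ary n (Expr n) (Expr n × Expr n)) ρ (let (d , e) = close n f) →
         ⟦ pos d :+ neg e ⟧↓ ρ ≈ ⟦ pos e :+ neg d ⟧↓ ρ → ⟦ d ⟧ ρ ≈ ⟦ e ⟧ ρ
  byRing n f ρ eq = ∙-cancelʳ (nd + ne) _ _ (begin
    ⟦ d ⟧ ρ + (nd + ne)     ≈⟨ +-assoc _ _ _ ⟨
    ⟦ d ⟧ ρ + nd + ne       ≈⟨ +-congʳ (+neg d ρ) ⟩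
    ⟦ pos d :+ neg e ⟧ₛ ρ   ≈⟨ prove ρ (pos d :+ neg e) (pos e :+ neg d) eq ⟩
    ⟦ pos e :+ neg d ⟧ₛ ρ   ≈⟨ +-congʳ (+neg e ρ) ⟨
    ⟦ e ⟧ ρ + ne + nd       ≈⟨ xy∙z≈xz∙y _ _ _ ⟩
    ⟦ e ⟧ ρ + nd + ne       ≈⟨ +-assoc _ _ _ ⟩
    ⟦ e ⟧ ρ + (nd + ne)     ∎)
    where
    d  = proj₁ (close n f)
    e  = proj₂ (close n f)
    nd = ⟦ neg d ⟧ₛ ρ
    ne = ⟦ neg e ⟧ₛ ρ

-- Likewise, an expression with inverses is decided as a formal quotient.
module AbelianGroupSolver (A : AbelianGroup 0ℓ 0ℓ) where
  open AbelianGroup A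
  open AbelianGroupProperties A using (∙-cancelʳ; x≈y⇒x∙y⁻¹≈ε)
  open CommutativeSemigroupProperties commutativeSemigroup using (interchange; xy∙z≈xz∙y)
  module M = CommutativeMonoidNormal commutativeMonoid
  open SetoidReasoning setoid

  infixl 7 _⊗_ _⊘_
  infix  4 _⊜_

  data Expr (n : ℕ) : Set where
    ′_  : Fin n → Expr n
    _⊗_ : Expr n → Expr n → Expr n
    recip : Expr n → Expr n
    #1  : Expr n

  _⊘_ : ∀ {n} → Expr n → Expr n → Expr n
  d ⊘ e = d ⊗ recip e

  _⊜_ : ∀ {n} → Expr n → Expr n → Expr n × Expr n
  _⊜_ = _,_

  private variable
    n : ℕ

  ⟦_⟧ : Expr n → Vec Carrier n → Carrier
  ⟦ ′ i ⟧ ρ   = lookup ρ i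
  ⟦ d ⊗ e ⟧ ρ = ⟦ d ⟧ ρ ∙ ⟦ e ⟧ ρ
  ⟦ recip e ⟧ ρ = ⟦ e ⟧ ρ ⁻¹
  ⟦ #1 ⟧ ρ    = ε

  num den : Expr n → M.Expr n
  num (′ i)   = M.var i
  num (d ⊗ e) = num d M.⊕ num e
  num (recip e) = den e
  num #1      = M.id
  den (′ i)   = M.id
  den (d ⊗ e) = den d M.⊕ den e
  den (recip e) = num e
  den #1      = M.id

  ∙den : ∀ (e : Expr n) ρ → ⟦ e ⟧ ρ ∙ M.⟦ den e ⟧ ρ ≈ M.⟦ num e ⟧ ρ
  ∙den (′ i) ρ   = identityʳ _
  ∙den (d ⊗ e) ρ = trans (interchange _ _ _ _) (∙-cong (∙den d ρ) (∙den e ρ))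
  ∙den (recip e) ρ = begin
    ⟦ e ⟧ ρ ⁻¹ ∙ M.⟦ num e ⟧ ρ                ≈⟨ ∙-congˡ (∙den e ρ) ⟨
    ⟦ e ⟧ ρ ⁻¹ ∙ (⟦ e ⟧ ρ ∙ M.⟦ den e ⟧ ρ)    ≈⟨ assoc _ _ _ ⟨
    ⟦ e ⟧ ρ ⁻¹ ∙ ⟦ e ⟧ ρ ∙ M.⟦ den e ⟧ ρ      ≈⟨ ∙-congʳ (inverseˡ _) ⟩
    ε ∙ M.⟦ den e ⟧ ρ                         ≈⟨ identityˡ _ ⟩
    M.⟦ den e ⟧ ρ                             ∎
  ∙den #1 ρ = identityʳ _

  close : ∀ n → N-ary n (Expr n) (Expr n × Expr n) → Expr n × Expr n
  close n f = f $ⁿ map ′_ (allFin n)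

  byAbelian : ∀ n (f : N-ary n (Expr n) (Expr n × Expr n)) ρ (let (d , e) = close n f) →
            M.normalise (num d M.⊕ den e) ≡ M.normalise (num e M.⊕ den d) →
            ⟦ d ⟧ ρ ≈ ⟦ e ⟧ ρ
  byAbelian n f ρ eq = ∙-cancelʳ (nd ∙ ne) _ _ (begin
    ⟦ d ⟧ ρ ∙ (nd ∙ ne)           ≈⟨ assoc _ _ _ ⟨
    ⟦ d ⟧ ρ ∙ nd ∙ ne             ≈⟨ ∙-congʳ (∙den d ρ) ⟩
    M.⟦ num d M.⊕ den e ⟧ ρ       ≈⟨ M.correct (num d M.⊕ den e) ρ ⟨
    _                             ≡⟨ ≡.cong (λ p → M.⟦ p ⟧⇓ ρ) eq ⟩
    _                             ≈⟨ M.correct (num e M.⊕ den d) ρ ⟩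
    M.⟦ num e M.⊕ den d ⟧ ρ       ≈⟨ ∙-congʳ (∙den e ρ) ⟨
    ⟦ e ⟧ ρ ∙ ne ∙ nd             ≈⟨ xy∙z≈xz∙y _ _ _ ⟩
    ⟦ e ⟧ ρ ∙ nd ∙ ne             ≈⟨ assoc _ _ _ ⟩
    ⟦ e ⟧ ρ ∙ (nd ∙ ne)           ∎)
    where
    d  = proj₁ (close n f)
    e  = proj₂ (close n f)
    nd = M.⟦ den d ⟧ ρ
    ne = M.⟦ den e ⟧ ρ

  Relation : Set
  Relation = ∃[ d ] ∃[ e ] d ≈ e

  -- Each hypothesis `d ≈ e` contributes a factor `d / e`, trivial in the group but not formally.
  -- Multiplying one side of a goal by these factors lets it become an identity of free abelian
  -- groups: the list of hypotheses is the certificate.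
  residue : List Relation → Carrier
  residue []                 = ε
  residue ((d , e , _) ∷ rs) = d ∙ e ⁻¹ ∙ residue rs

  residue≈ε : ∀ rs → residue rs ≈ ε
  residue≈ε []                   = refl
  residue≈ε ((d , e , d≈e) ∷ rs) =
    trans (∙-cong (x≈y⇒x∙y⁻¹≈ε d≈e) (residue≈ε rs)) (identityˡ ε)

  modulo : ∀ rs {x y} → x ≈ y ∙ residue rs → x ≈ y
  modulo rs x≈ = trans x≈ (trans (∙-congˡ (residue≈ε rs)) (identityʳ _))

-- Ordered fields and n-th roots from completeness.

module Reals (em : ExcludedMiddle 0ℓ) (R : CompleteOrderedField) where
  open CompleteOrderedField R public
  open IsTotalOrder isTotalOrder public
    using (total; antisym)
    renaming ( refl to ≤-refl; reflexive to ≤-reflexive; trans to ≤-trans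
             ; ≤-respˡ-≈ to ≤-respˡ; ≤-respʳ-≈ to ≤-respʳ)
  open CommutativeSemiringExp commutativeSemiring public using (_^_; ^-distrib-*)
  open SemiringExp semiring public using (^-congˡ)
  open CommutativeSemigroupProperties *-commutativeSemigroup using (x∙yz≈y∙xz)
  open RingSolver commutativeRing

  infix 4 _<_

  _<_ : Rel ℝ 0ℓ
  x < y = ¬ (y ≤ x)

  ≮⇒≥ : ∀ {x y} → ¬ (x < y) → y ≤ x
  ≮⇒≥ = decidable-stable em

  <⇒≤ : ∀ {x y} → x < y → x ≤ y
  <⇒≤ {x} {y} x<y with total x y
  ... | inj₁ x≤y = x≤y
  ... | inj₂ y≤x = contradiction y≤x x<y

  <-≤-trans : ∀ {x y z} → x < y → y ≤ z → x < z
  <-≤-trans x<y y≤z z≤x = x<y (≤-trans y≤z z≤x)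

  +-monoʳ-≤ : ∀ z {x y} → x ≤ y → z + x ≤ z + y
  +-monoʳ-≤ z x≤y = ≤-respˡ (+-comm _ _) (≤-respʳ (+-comm _ _) (+-monoˡ-≤ z x≤y))

  +-cancelʳ-≤ : ∀ z {x y} → x + z ≤ y + z → x ≤ y
  +-cancelʳ-≤ z p = ≤-respˡ (cancel _) (≤-respʳ (cancel _) (+-monoˡ-≤ (- z) p))
    where
    cancel : ∀ x → x + z + - z ≈ x
    cancel x = byRing 2 (λ x z → x ⊕ z ⊕ ⊝ z ⊜ x) (x ∷ z ∷ []) refl

  ≤⇒0≤- : ∀ {x y} → x ≤ y → 0# ≤ y - x
  ≤⇒0≤- {x} x≤y = ≤-respˡ (-‿inverseʳ x) (+-monoˡ-≤ (- x) x≤y)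

  0≤-⇒≤ : ∀ {x y} → 0# ≤ y - x → x ≤ y
  0≤-⇒≤ {x} {y} p = +-cancelʳ-≤ (- x) (≤-respˡ (sym (-‿inverseʳ x)) p)

  *-monoˡ-≤ : ∀ {z x y} → 0# ≤ z → x ≤ y → z * x ≤ z * y
  *-monoˡ-≤ {z} {x} {y} 0≤z x≤y = 0≤-⇒≤ (≤-respʳ
    (byRing 3 (λ z x y → z ⊗ (y ⊖ x) ⊜ z ⊗ y ⊖ z ⊗ x) (z ∷ x ∷ y ∷ []) refl)
    (*-nonNeg 0≤z (≤⇒0≤- x≤y)))

  *-monoʳ-≤ : ∀ {z x y} → 0# ≤ z → x ≤ y → x * z ≤ y * z
  *-monoʳ-≤ 0≤z x≤y = ≤-respˡ (*-comm _ _) (≤-respʳ (*-comm _ _) (*-monoˡ-≤ 0≤z x≤y))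

  *-mono-≤ : ∀ {x y u v} → 0# ≤ u → 0# ≤ y → x ≤ y → u ≤ v → x * u ≤ y * v
  *-mono-≤ 0≤u 0≤y x≤y u≤v = ≤-trans (*-monoʳ-≤ 0≤u x≤y) (*-monoˡ-≤ 0≤y u≤v)

  0≤x² : ∀ x → 0# ≤ x * x
  0≤x² x with total 0# x
  ... | inj₁ 0≤x = *-nonNeg 0≤x 0≤x
  ... | inj₂ x≤0 = ≤-respʳ (byRing 1 (λ x → (#0 ⊖ x) ⊗ (#0 ⊖ x) ⊜ x ⊗ x) (x ∷ []) refl)
                     (*-nonNeg (≤⇒0≤- x≤0) (≤⇒0≤- x≤0))

  0≤1 : 0# ≤ 1#
  0≤1 = ≤-respʳ (*-identityˡ 1#) (0≤x² 1#)

  0<1 : 0# < 1#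
  0<1 1≤0 = 0≉1 (antisym 0≤1 1≤0)

  0<⇒≉0 : ∀ {x} → 0# < x → ¬ (x ≈ 0#)
  0<⇒≉0 0<x x≈0 = 0<x (≤-reflexive x≈0)

  ≉0⇒0< : ∀ {x} → 0# ≤ x → ¬ (x ≈ 0#) → 0# < x
  ≉0⇒0< 0≤x x≉0 x≤0 = x≉0 (antisym x≤0 0≤x)

  reciprocal : ∀ {x} → 0# < x → ∃[ y ] 0# < y × x * y ≈ 1#
  reciprocal {x} 0<x =
    let y , xy≈1 = invertible x (0<⇒≉0 0<x) in
    y , (λ y≤0 → 0<1 (≤-respˡ xy≈1 (≤-respʳ (zeroʳ x) (*-monoˡ-≤ (<⇒≤ 0<x) y≤0)))) , xy≈1

  *-cancelʳ-≤ : ∀ {z x y} → 0# < z → x * z ≤ y * z → x ≤ y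
  *-cancelʳ-≤ {z} 0<z p =
    let w , 0<w , zw≈1 = reciprocal 0<z
        cancel = λ x → trans (*-assoc x z w) (trans (*-congˡ zw≈1) (*-identityʳ x))
    in ≤-respˡ (cancel _) (≤-respʳ (cancel _) (*-monoʳ-≤ (<⇒≤ 0<w) p))

  *-pos : ∀ {x y} → 0# < x → 0# < y → 0# < x * y
  *-pos 0<x 0<y xy≤0 = 0<x (*-cancelʳ-≤ 0<y (≤-respʳ (sym (zeroˡ _)) xy≤0))

  between : ∀ {x y} → x < y → ∃[ z ] x < z × z < y
  between {x} {y} x<y =
    let h , 0<h , 2h≈1 = reciprocal 0<2
        z = (x + y) * h
        2z≈x+y = trans (*-assoc (x + y) h _)
                   (trans (*-congˡ (trans (*-comm h _) 2h≈1)) (*-identityʳ _))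
        x+x≈x2 = λ x → byRing 1 (λ x → x ⊗ (#1 ⊕ #1) ⊜ x ⊕ x) (x ∷ []) refl
    in z
    , (λ z≤x → x<y (+-cancelʳ-≤ x (≤-respˡ (+-comm x y) (≤-respˡ 2z≈x+y
         (≤-respʳ (x+x≈x2 x) (*-monoʳ-≤ (<⇒≤ 0<2) z≤x))))))
    , (λ y≤z → x<y (+-cancelʳ-≤ y (≤-respʳ 2z≈x+y
         (≤-respˡ (x+x≈x2 y) (*-monoʳ-≤ (<⇒≤ 0<2) y≤z)))))
    where
    0<2 : 0# < 1# + 1#
    0<2 = <-≤-trans 0<1 (≤-respˡ (+-identityʳ 1#) (+-monoʳ-≤ 1# 0≤1))

  ^-pos : ∀ {x} n → 0# < x → 0# < x ^ n
  ^-pos zero    0<x = 0<1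
  ^-pos (suc n) 0<x = *-pos 0<x (^-pos n 0<x)

  ^-mono-≤ : ∀ {x y} n → 0# < x → x ≤ y → x ^ n ≤ y ^ n
  ^-mono-≤ zero    0<x x≤y = ≤-refl
  ^-mono-≤ (suc n) 0<x x≤y =
    *-mono-≤ (<⇒≤ (^-pos n 0<x)) (≤-trans (<⇒≤ 0<x) x≤y) x≤y (^-mono-≤ n 0<x x≤y)

  1^n≈1 : ∀ n → 1# ^ n ≈ 1#
  1^n≈1 zero    = refl
  1^n≈1 (suc n) = trans (*-identityˡ _) (1^n≈1 n)

  -- Nothing is assumed about the sign of `x`: in the refuted case `y < x` it is positive. This
  -- matters for the set `x ^ n ≤ a`, which may contain negative numbers.
  ^-cancel-≤ : ∀ {x y} n .{{_ : NonZero n}} → 0# < y → x ^ n ≤ y ^ n → x ≤ y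
  ^-cancel-≤ {x} {y} (suc n) 0<y p = ≮⇒≥ λ y<x →
    y<x (*-cancelʳ-≤ (^-pos n (<-≤-trans 0<y (<⇒≤ y<x)))
      (≤-trans p (*-monoˡ-≤ (<⇒≤ 0<y) (^-mono-≤ n 0<y (<⇒≤ y<x)))))

  ^-injective : ∀ {x y} n .{{_ : NonZero n}} → 0# < x → 0# < y → x ^ n ≈ y ^ n → x ≈ y
  ^-injective n 0<x 0<y p = antisym
    (^-cancel-≤ n 0<y (≤-reflexive p)) (^-cancel-≤ n 0<x (≤-reflexive (sym p)))

  -- Replaces the continuity of x ↦ xⁿ in the construction of roots.
  gap : ∀ n {u v} → 0# < u → u < v → ∃[ q ] 0# < q × q < 1# × u ≤ v * q ^ n
  gap zero {v = v} 0<u u<v =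
    let q , 0<q , q<1 = between 0<1
    in q , 0<q , q<1 , ≤-respʳ (sym (*-identityʳ v)) (<⇒≤ u<v)
  gap (suc n) {u} {v} 0<u u<v =
    -- The gap is split at `w`: the ratio `p = u / w` leads from `w` down to `u`, and n factors `r`
    -- lead from `v` to a value still at least `w`. The larger of the two ratios serves for all n +
    -- 1 factors.
    let w , u<w , w<v             = between u<v
        0<w                       = <-≤-trans 0<u (<⇒≤ u<w)
        0<v                       = <-≤-trans 0<w (<⇒≤ w<v)
        w⁻¹ , 0<w⁻¹ , ww⁻¹≈1      = reciprocal 0<w
        p                         = u * w⁻¹
        0<p                       = *-pos 0<u 0<w⁻¹
        pw≈u                      = trans (*-assoc u w⁻¹ w)
                                      (trans (*-congˡ (trans (*-comm w⁻¹ w) ww⁻¹≈1)) (*-identityʳ u))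
        p<1                       = λ 1≤p → u<w
                                      (≤-respʳ pw≈u (≤-respˡ (*-identityˡ w) (*-monoʳ-≤ (<⇒≤ 0<w) 1≤p)))
        r , 0<r , r<1 , w≤vrⁿ     = gap n 0<w w<v
    in max r p 0<v 0<w 0<r r<1 0<p p<1 pw≈u w≤vrⁿ
    where
    bound : ∀ {w} q r p → 0# < v → 0# < w → 0# < r → 0# < p → r ≤ q → p ≤ q →
            p * w ≈ u → w ≤ v * r ^ n → u ≤ v * q ^ suc n
    bound {w} q r p 0<v 0<w 0<r 0<p r≤q p≤q pw≈u w≤vrⁿ =
      ≤-respˡ pw≈u (≤-respʳ (x∙yz≈y∙xz q v (q ^ n))
        (*-mono-≤ {p} {q} {w} {v * q ^ n} (<⇒≤ 0<w) (≤-trans (<⇒≤ 0<p) p≤q) p≤q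
          (≤-trans w≤vrⁿ (*-monoˡ-≤ (<⇒≤ 0<v) (^-mono-≤ n 0<r r≤q)))))

    max : ∀ {w} r p → 0# < v → 0# < w → 0# < r → r < 1# → 0# < p → p < 1# →
          p * w ≈ u → w ≤ v * r ^ n → ∃[ q ] 0# < q × q < 1# × u ≤ v * q ^ suc n
    max r p 0<v 0<w 0<r r<1 0<p p<1 pw≈u w≤vrⁿ with total r p
    ... | inj₁ r≤p = p , 0<p , p<1 , bound p r p 0<v 0<w 0<r 0<p r≤p ≤-refl pw≈u w≤vrⁿ
    ... | inj₂ p≤r = r , 0<r , r<1 , bound r r p 0<v 0<w 0<r 0<p ≤-refl p≤r pw≈u w≤vrⁿ

  module _ (n : ℕ) {a s : ℝ} (0<a : 0# < a) (0<s : 0# < s)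
           (s-sup : IsSupremum (λ x → x ^ suc n ≤ a) s) where

    private
      s≰sq : ∀ {q} → q < 1# → ¬ (s ≤ s * q)
      s≰sq q<1 s≤sq = q<1 (*-cancelʳ-≤ 0<s
        (≤-respˡ (sym (*-identityˡ s)) (≤-respʳ (*-comm _ _) s≤sq)))

    -- Otherwise `s q`, with the ratio `q` from `gap`, would be a smaller upper bound.
    sⁿ≮a : ¬ (a < s ^ suc n)
    sⁿ≮a a<sⁿ =
      let q , 0<q , q<1 , a≤sⁿqⁿ = gap (suc n) 0<a a<sⁿ
      in s≰sq q<1 (proj₂ s-sup (s * q) λ x xⁿ≤a →
           ^-cancel-≤ (suc n) (*-pos 0<s 0<q)
             (≤-trans xⁿ≤a (≤-respʳ (sym (^-distrib-* s q (suc n))) a≤sⁿqⁿ)))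

    -- Otherwise `s / q`, with the ratio `q` from `gap`, would lie in the set and exceed `s`.
    a≮sⁿ : ¬ (s ^ suc n < a)
    a≮sⁿ sⁿ<a =
      let q , 0<q , q<1 , sⁿ≤aqⁿ = gap (suc n) (^-pos (suc n) 0<s) sⁿ<a
          r , 0<r , qr≈1 = reciprocal 0<q
          qⁿrⁿ≈1 = trans (sym (^-distrib-* q r (suc n))) (trans (^-congˡ (suc n) qr≈1) (1^n≈1 (suc n)))
          sr≤s = proj₁ s-sup (s * r) (≤-respˡ (sym (^-distrib-* s r (suc n)))
                   (≤-respʳ (trans (*-assoc a _ _) (trans (*-congˡ qⁿrⁿ≈1) (*-identityʳ a)))
                     (*-monoʳ-≤ (<⇒≤ (^-pos (suc n) 0<r)) sⁿ≤aqⁿ)))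
          srq≈s = trans (*-assoc s r q) (trans (*-congˡ (trans (*-comm r q) qr≈1)) (*-identityʳ s))
      in s≰sq q<1 (≤-respˡ srq≈s (*-monoʳ-≤ (<⇒≤ 0<q) sr≤s))

  root : ∀ n .{{_ : NonZero n}} {a} → 0# < a → ∃[ s ] 0# < s × s ^ n ≈ a
  root (suc n) {a} 0<a =
    let x , 0<x , x∈S   = inhabitant
        s , s-sup       = complete S (x , x∈S) (1# + a , bounded)
        0<s             = <-≤-trans 0<x (proj₁ s-sup x x∈S)
    in s , 0<s , antisym (≮⇒≥ (sⁿ≮a n 0<a 0<s s-sup)) (≮⇒≥ (a≮sⁿ n 0<a 0<s s-sup))
    where
    S : Pred ℝ 0ℓ
    S x = x ^ suc n ≤ a

    inhabitant : ∃[ x ] 0# < x × S x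
    -- The witness is the minimum of 1 and `a`.
    inhabitant with total 1# a
    ... | inj₁ 1≤a = 1# , 0<1 , ≤-respˡ (sym (1^n≈1 (suc n))) 1≤a
    ... | inj₂ a≤1 = a , 0<a , ≤-respʳ (*-identityʳ a)
                       (*-monoˡ-≤ (<⇒≤ 0<a) (≤-respʳ (1^n≈1 n) (^-mono-≤ n 0<a a≤1)))

    bounded : IsUpperBound S (1# + a)
    -- Beyond `1 + a` one has `x ≥ 1`, hence `x ≤ xⁿ⁺¹ ≤ a`, a contradiction.
    bounded x xⁿ≤a = ≮⇒≥ λ 1+a<x →
      let 1≤x = ≤-trans (≤-respˡ (+-identityʳ 1#) (+-monoʳ-≤ 1# (<⇒≤ 0<a))) (<⇒≤ 1+a<x)
          x≤a = ≤-trans (≤-respˡ (*-identityʳ x) (*-monoˡ-≤ (≤-trans 0≤1 1≤x)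
                  (≤-respˡ (1^n≈1 n) (^-mono-≤ n 0<1 1≤x)))) xⁿ≤a
      in 1+a<x (≤-trans x≤a (≤-respˡ (+-identityˡ a) (+-monoˡ-≤ a 0≤1)))

-- Complex numbers, their units, and units modulo the unit circle.

module ComplexNumbers (em : ExcludedMiddle 0ℓ) (F : CompleteOrderedField) where
  module R = Reals em F
  open R using (ℝ; _^_)
  open RingSolver R.commutativeRing
  open Complex F

  infix 8 -_

  -_ : ℂ → ℂ
  - z = (R.- re z) +i (R.- im z)

  +-*-isCommutativeRing : IsCommutativeRing _≈_ _+_ _*_ -_ 0# 1#
  +-*-isCommutativeRing = record
    { isRing = record
      { +-isAbelianGroup = record
        { isGroup = record
          { isMonoid = record
            { isSemigroup = record
              { isMagma = record
                { isEquivalence = record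
                  { refl  = R.refl , R.refl
                  ; sym   = λ (p , q) → R.sym p , R.sym q
                  ; trans = λ (p , q) (p′ , q′) → R.trans p p′ , R.trans q q′
                  }
                ; ∙-cong = λ (p , q) (p′ , q′) → R.+-cong p p′ , R.+-cong q q′
                }
              ; assoc = λ _ _ _ → R.+-assoc _ _ _ , R.+-assoc _ _ _
              }
            ; identity = (λ _ → R.+-identityˡ _ , R.+-identityˡ _)
                       , (λ _ → R.+-identityʳ _ , R.+-identityʳ _)
            }
          ; inverse = (λ _ → R.-‿inverseˡ _ , R.-‿inverseˡ _)
                    , (λ _ → R.-‿inverseʳ _ , R.-‿inverseʳ _)
          ; ⁻¹-cong = λ (p , q) → R.-‿cong p , R.-‿cong q
          }
        ; comm = λ _ _ → R.+-comm _ _ , R.+-comm _ _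
        }
      ; *-cong = λ (p , q) (p′ , q′) →
          R.+-cong (R.*-cong p p′) (R.-‿cong (R.*-cong q q′)) ,
          R.+-cong (R.*-cong p q′) (R.*-cong q p′)
      ; *-assoc = λ (a +i b) (c +i d) (e +i f) →
          byRing 6 (λ a b c d e f → (a ⊗ c ⊖ b ⊗ d) ⊗ e ⊖ (a ⊗ d ⊕ b ⊗ c) ⊗ f
            ⊜ a ⊗ (c ⊗ e ⊖ d ⊗ f) ⊖ b ⊗ (c ⊗ f ⊕ d ⊗ e)) (a ∷ b ∷ c ∷ d ∷ e ∷ f ∷ []) R.refl ,
          byRing 6 (λ a b c d e f → (a ⊗ c ⊖ b ⊗ d) ⊗ f ⊕ (a ⊗ d ⊕ b ⊗ c) ⊗ e
            ⊜ a ⊗ (c ⊗ f ⊕ d ⊗ e) ⊕ b ⊗ (c ⊗ e ⊖ d ⊗ f)) (a ∷ b ∷ c ∷ d ∷ e ∷ f ∷ []) R.refl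
      ; *-identity =
          (λ (a +i b) →
            byRing 2 (λ a b → #1 ⊗ a ⊖ #0 ⊗ b ⊜ a) (a ∷ b ∷ []) R.refl ,
            byRing 2 (λ a b → #1 ⊗ b ⊕ #0 ⊗ a ⊜ b) (a ∷ b ∷ []) R.refl) ,
          (λ (a +i b) →
            byRing 2 (λ a b → a ⊗ #1 ⊖ b ⊗ #0 ⊜ a) (a ∷ b ∷ []) R.refl ,
            byRing 2 (λ a b → a ⊗ #0 ⊕ b ⊗ #1 ⊜ b) (a ∷ b ∷ []) R.refl)
      ; distrib =
          (λ (a +i b) (c +i d) (e +i f) →
            byRing 6 (λ a b c d e f → a ⊗ (c ⊕ e) ⊖ b ⊗ (d ⊕ f) ⊜ (a ⊗ c ⊖ b ⊗ d) ⊕ (a ⊗ e ⊖ b ⊗ f))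
              (a ∷ b ∷ c ∷ d ∷ e ∷ f ∷ []) R.refl ,
            byRing 6 (λ a b c d e f → a ⊗ (d ⊕ f) ⊕ b ⊗ (c ⊕ e) ⊜ (a ⊗ d ⊕ b ⊗ c) ⊕ (a ⊗ f ⊕ b ⊗ e))
              (a ∷ b ∷ c ∷ d ∷ e ∷ f ∷ []) R.refl) ,
          (λ (a +i b) (c +i d) (e +i f) →
            byRing 6 (λ a b c d e f → (c ⊕ e) ⊗ a ⊖ (d ⊕ f) ⊗ b ⊜ (c ⊗ a ⊖ d ⊗ b) ⊕ (e ⊗ a ⊖ f ⊗ b))
              (a ∷ b ∷ c ∷ d ∷ e ∷ f ∷ []) R.refl ,
            byRing 6 (λ a b c d e f → (c ⊕ e) ⊗ b ⊕ (d ⊕ f) ⊗ a ⊜ (c ⊗ b ⊕ d ⊗ a) ⊕ (e ⊗ b ⊕ f ⊗ a))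
              (a ∷ b ∷ c ∷ d ∷ e ∷ f ∷ []) R.refl)
      }
    ; *-comm = λ (a +i b) (c +i d) →
        byRing 4 (λ a b c d → a ⊗ c ⊖ b ⊗ d ⊜ c ⊗ a ⊖ d ⊗ b) (a ∷ b ∷ c ∷ d ∷ []) R.refl ,
        byRing 4 (λ a b c d → a ⊗ d ⊕ b ⊗ c ⊜ c ⊗ b ⊕ d ⊗ a) (a ∷ b ∷ c ∷ d ∷ []) R.refl
    }

  commutativeRing : CommutativeRing 0ℓ 0ℓ
  commutativeRing = record { isCommutativeRing = +-*-isCommutativeRing }

  open CommutativeRing commutativeRing public
    using ( setoid; refl; reflexive; sym; trans; +-cong; +-commutativeMonoid
          ; *-cong; *-congˡ; *-congʳ; *-comm; *-assoc; *-identityˡ; *-identityʳ; zeroˡ; zeroʳ)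
  open CommutativeSemigroupProperties (CommutativeRing.*-commutativeSemigroup commutativeRing)
    using (interchange)
  open SetoidReasoning setoid

  N : ℂ → ℝ
  N z = re z R.* re z R.+ im z R.* im z

  N-cong : ∀ {z w} → z ≈ w → N z R.≈ N w
  N-cong (p , q) = R.+-cong (R.*-cong p p) (R.*-cong q q)

  N-* : ∀ z w → N (z * w) R.≈ N z R.* N w
  N-* (a +i b) (c +i d) =
    byRing 4 (λ a b c d → (a ⊗ c ⊖ b ⊗ d) ⊗ (a ⊗ c ⊖ b ⊗ d) ⊕ (a ⊗ d ⊕ b ⊗ c) ⊗ (a ⊗ d ⊕ b ⊗ c)
      ⊜ (a ⊗ a ⊕ b ⊗ b) ⊗ (c ⊗ c ⊕ d ⊗ d)) (a ∷ b ∷ c ∷ d ∷ []) R.refl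

  conj-cong : ∀ {z w} → z ≈ w → conj z ≈ conj w
  conj-cong (p , q) = p , R.-‿cong q

  fromℝ : ℝ → ℂ
  fromℝ x = x +i R.0#

  fromℝ-cong : ∀ {x y} → x R.≈ y → fromℝ x ≈ fromℝ y
  fromℝ-cong p = p , R.refl

  fromℝ-* : ∀ x y → fromℝ x * fromℝ y ≈ fromℝ (x R.* y)
  fromℝ-* x y =
    byRing 2 (λ x y → x ⊗ y ⊖ #0 ⊗ #0 ⊜ x ⊗ y) (x ∷ y ∷ []) R.refl ,
    byRing 2 (λ x y → x ⊗ #0 ⊕ #0 ⊗ y ⊜ #0) (x ∷ y ∷ []) R.refl

  N-fromℝ : ∀ x → N (fromℝ x) R.≈ x R.* x
  N-fromℝ x = byRing 1 (λ x → x ⊗ x ⊕ #0 ⊗ #0 ⊜ x ⊗ x) (x ∷ []) R.refl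

  N1≈1 : N 1# R.≈ R.1#
  N1≈1 = R.trans (N-fromℝ R.1#) (R.*-identityˡ R.1#)

  conj0≈0 : conj 0# ≈ 0#
  conj0≈0 = R.refl , byRing 0 (⊝ #0 ⊜ #0) [] R.refl

  z*z̄≈N : ∀ z → z * conj z ≈ fromℝ (N z)
  z*z̄≈N (a +i b) =
    byRing 2 (λ a b → a ⊗ a ⊖ b ⊗ (⊝ b) ⊜ a ⊗ a ⊕ b ⊗ b) (a ∷ b ∷ []) R.refl ,
    byRing 2 (λ a b → a ⊗ (⊝ b) ⊕ b ⊗ a ⊜ #0) (a ∷ b ∷ []) R.refl

  0≤N : ∀ z → R.0# R.≤ N z
  0≤N z = R.≤-trans (R.0≤x² (re z))
    (R.≤-respˡ (R.+-identityʳ _) (R.+-monoʳ-≤ _ (R.0≤x² (im z))))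

  x²≤0⇒x≈0 : ∀ {x} → x R.* x R.≤ R.0# → x R.≈ R.0#
  x²≤0⇒x≈0 {x} x²≤0 = decidable-stable em λ x≉0 →
    let y , xy≈1 = R.invertible x x≉0
    in x≉0 (R.trans (R.sym (R.*-identityʳ x)) (R.trans (R.*-congˡ (R.sym xy≈1))
         (R.trans (R.sym (R.*-assoc x x y))
           (R.trans (R.*-congʳ (R.antisym x²≤0 (R.0≤x² x))) (R.zeroˡ y)))))

  N≈0⇒≈0 : ∀ {z} → N z R.≈ R.0# → z ≈ 0#
  N≈0⇒≈0 {z} Nz≈0 =
    x²≤0⇒x≈0 (R.≤-trans (R.≤-respˡ (R.+-identityʳ _) (R.+-monoʳ-≤ _ (R.0≤x² (im z)))) (R.≤-reflexive Nz≈0)) ,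
    x²≤0⇒x≈0 (R.≤-trans (R.≤-respˡ (R.+-identityˡ _) (R.+-monoˡ-≤ _ (R.0≤x² (re z)))) (R.≤-reflexive Nz≈0))

  1≉0 : ¬ (1# ≈ 0#)
  1≉0 (1≈0 , _) = R.0≉1 (R.sym 1≈0)

  value≉0 : ∀ u → ¬ (value u ≈ 0#)
  value≉0 u u≈0 = 1≉0 (trans (sym (ℂˣ.inverseʳ u)) (trans (*-congʳ u≈0) (zeroˡ (inv u))))

  *-cancelʳ : ∀ u {z w} → z * value u ≈ w * value u → z ≈ w
  *-cancelʳ u {z} {w} p = trans (sym (cancel z)) (trans (*-congʳ p) (cancel w))
    where
    cancel : ∀ z → z * value u * inv u ≈ z
    cancel z = trans (*-assoc z (value u) (inv u)) (trans (*-congˡ (ℂˣ.inverseʳ u)) (*-identityʳ z))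

  abstract
    inverse : ∀ z → ¬ (z ≈ 0#) → ∃[ w ] z * w ≈ 1#
    inverse z z≉0 =
      let w , Nz*w≈1 = R.invertible (N z) (λ Nz≈0 → z≉0 (N≈0⇒≈0 Nz≈0))
      in conj z * fromℝ w , (begin
        z * (conj z * fromℝ w)   ≈⟨ *-assoc z (conj z) (fromℝ w) ⟨
        z * conj z * fromℝ w     ≈⟨ *-congʳ (z*z̄≈N z) ⟩
        fromℝ (N z) * fromℝ w    ≈⟨ fromℝ-* (N z) w ⟩
        fromℝ (N z R.* w)        ≈⟨ fromℝ-cong Nz*w≈1 ⟩
        1#                       ∎)

  nonzero : ∀ z → ¬ (z ≈ 0#) → ℂˣ
  nonzero z z≉0 =
    let w , zw≈1 = inverse z z≉0
    in record { value = z ; inv = w ; inverseʳ = zw≈1 }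

  -- The value at 0 is irrelevant.
  unit : ℂ → ℂˣ
  unit z with em {z ≈ 0#}
  ... | yes z≈0 = record { value = 1# ; inv = 1# ; inverseʳ = *-identityˡ 1# }
  ... | no  z≉0 = nonzero z z≉0

  value-unit : ∀ {z} → ¬ (z ≈ 0#) → value (unit z) ≈ z
  value-unit {z} z≉0 with em {z ≈ 0#}
  ... | yes z≈0 = contradiction z≈0 z≉0
  ... | no  _   = refl

  unit-cong : ∀ {z w} → z ≈ w → value (unit z) ≈ value (unit w)
  unit-cong {z} {w} z≈w with em {z ≈ 0#} | em {w ≈ 0#}
  ... | yes _   | yes _   = refl
  ... | yes z≈0 | no  w≉0 = contradiction (trans (sym z≈w) z≈0) w≉0
  ... | no  z≉0 | yes w≈0 = contradiction (trans z≈w w≈0) z≉0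
  ... | no  _   | no  _   = z≈w

  infixl 7 _·_
  infix  8 _⁻¹ˣ
  infix  4 _≈ˣ_

  _≈ˣ_ : ℂˣ → ℂˣ → Set
  u ≈ˣ v = value u ≈ value v

  abstract
    *-inverseʳ : ∀ u v → value u * value v * (inv u * inv v) ≈ 1#
    *-inverseʳ u v = trans (interchange _ _ _ _)
      (trans (*-cong (ℂˣ.inverseʳ u) (ℂˣ.inverseʳ v)) (*-identityˡ 1#))

    inv-inverseˡ : ∀ u → inv u * value u ≈ 1#
    inv-inverseˡ u = trans (*-comm _ _) (ℂˣ.inverseʳ u)

  _·_ : ℂˣ → ℂˣ → ℂˣ
  u · v = record { value = value u * value v ; inv = inv u * inv v ; inverseʳ = *-inverseʳ u v }

  1ˣ : ℂˣ
  1ˣ = record { value = 1# ; inv = 1# ; inverseʳ = *-identityˡ 1# }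

  _⁻¹ˣ : ℂˣ → ℂˣ
  u ⁻¹ˣ = record { value = inv u ; inv = value u ; inverseʳ = inv-inverseˡ u }

  inv-cong : ∀ {u v} → u ≈ˣ v → inv u ≈ inv v
  inv-cong {u} {v} u≈v = *-cancelʳ u
    (trans (ℂˣ.inverseʳ (u ⁻¹ˣ)) (sym (trans (*-congˡ u≈v) (ℂˣ.inverseʳ (v ⁻¹ˣ)))))

  ·-isAbelianGroup : IsAbelianGroup _≈ˣ_ _·_ 1ˣ _⁻¹ˣ
  ·-isAbelianGroup = record
    { isGroup = record
      { isMonoid = record
        { isSemigroup = record
          { isMagma = record
            { isEquivalence = record { refl = refl ; sym = sym ; trans = trans }
            ; ∙-cong        = *-cong
            }
          ; assoc = λ _ _ _ → *-assoc _ _ _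
          }
        ; identity = (λ _ → *-identityˡ _) , (λ _ → *-identityʳ _)
        }
      ; inverse = (λ u → ℂˣ.inverseʳ (u ⁻¹ˣ)) , (λ u → ℂˣ.inverseʳ u)
      ; ⁻¹-cong = λ {u} {v} → inv-cong {u} {v}
      }
    ; comm = λ _ _ → *-comm _ _
    }

  unitGroup : AbelianGroup 0ℓ 0ℓ
  unitGroup = record { isAbelianGroup = ·-isAbelianGroup }

  ∣_∣≈1 : ℂˣ → Set
  ∣ u ∣≈1 = N (value u) R.≈ R.1#

  0<N : ∀ u → R.0# R.< N (value u)
  0<N u = R.≉0⇒0< (0≤N (value u)) (λ Nu≈0 → value≉0 u (N≈0⇒≈0 Nu≈0))

  ∣∣≈1-· : ∀ u v → ∣ u ∣≈1 → ∣ v ∣≈1 → ∣ u · v ∣≈1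
  ∣∣≈1-· u v p q = R.trans (N-* (value u) (value v)) (R.trans (R.*-cong p q) (R.*-identityˡ _))

  ∣unit∣≈1 : ∀ {z} → (¬ (z ≈ 0#) → N z R.≈ R.1#) → ∣ unit z ∣≈1
  ∣unit∣≈1 {z} Nz≈1 with em {z ≈ 0#}
  ... | yes _   = N1≈1
  ... | no  z≉0 = Nz≈1 z≉0

  ratio≈1 : ∀ {u v} → u ≈ˣ 1ˣ → v ≈ˣ 1ˣ → u · v ⁻¹ˣ ≈ˣ 1ˣ
  ratio≈1 {u} {v} u≈1 v≈1 = trans (*-cong u≈1 (inv-cong {v} {1ˣ} v≈1)) (*-identityˡ 1#)

  N-inverse : ∀ u → N (value u) R.* N (inv u) R.≈ R.1#
  N-inverse u = R.trans (R.sym (N-* (value u) (inv u))) (R.trans (N-cong (ℂˣ.inverseʳ u)) N1≈1)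

  ∣∣≈1-⁻¹ : ∀ u → ∣ u ∣≈1 → ∣ u ⁻¹ˣ ∣≈1
  ∣∣≈1-⁻¹ u p = R.trans (R.sym (R.*-identityˡ _)) (R.trans (R.*-congʳ (R.sym p)) (N-inverse u))

  -- ℂˣ modulo the unit circle.
  ·-isAbelianGroup-modulus :
    IsAbelianGroup (λ u v → N (value u) R.≈ N (value v)) _·_ 1ˣ _⁻¹ˣ
  ·-isAbelianGroup-modulus = record
    { isGroup = record
      { isMonoid = record
        { isSemigroup = record
          { isMagma = record
            { isEquivalence = record { refl = R.refl ; sym = R.sym ; trans = R.trans }
            ; ∙-cong        = λ p q → R.trans (N-* _ _) (R.trans (R.*-cong p q) (R.sym (N-* _ _)))
            }
          ; assoc = λ _ _ _ → N-cong (*-assoc _ _ _)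
          }
        ; identity = (λ _ → N-cong (*-identityˡ _)) , (λ _ → N-cong (*-identityʳ _))
        }
      ; inverse = (λ u → N-cong (ℂˣ.inverseʳ (u ⁻¹ˣ))) , (λ u → N-cong (ℂˣ.inverseʳ u))
      ; ⁻¹-cong = λ {u} {v} u≈v → R.trans (R.sym (R.*-identityʳ _)) (R.trans (R.*-congˡ (R.sym (N-inverse v)))
          (R.trans (R.*-congˡ (R.*-congʳ (R.sym u≈v))) (R.trans (R.sym (R.*-assoc _ _ _))
            (R.trans (R.*-congʳ (R.trans (R.*-comm _ _) (N-inverse u))) (R.*-identityˡ _)))))
      }
    ; comm = λ _ _ → N-cong (*-comm _ _)
    }

  modulusGroup : AbelianGroup 0ℓ 0ℓ
  modulusGroup = record { isAbelianGroup = ·-isAbelianGroup-modulus }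

  private module |ℂˣ| = AbelianGroup modulusGroup

  infixr 8 _×ˣ_

  _×ˣ_ : ℕ → ℂˣ → ℂˣ
  _×ˣ_ = multiple |ℂˣ|.rawMonoid

  N-×ˣ : ∀ n u → N (value (n ×ˣ u)) R.≈ N (value u) ^ n
  N-×ˣ zero    u = N1≈1
  N-×ˣ (suc n) u = R.trans (N-* (value u) (value (n ×ˣ u))) (R.*-congˡ (N-×ˣ n u))

  fromℝ⁺ : ∀ x → R.0# R.< x → ℂˣ
  fromℝ⁺ x 0<x =
    let y , _ , xy≈1 = R.reciprocal 0<x
    in record { value = fromℝ x ; inv = fromℝ y ; inverseʳ = trans (fromℝ-* x y) (fromℝ-cong xy≈1) }

  ∣_∣ : ℂˣ → ℂˣ
  ∣ u ∣ = let x , 0<x , _ = R.root 2 (0<N u) in fromℝ⁺ x 0<x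

  ∣∣-square : ∀ u → value (∣ u ∣ · ∣ u ∣) ≈ fromℝ (N (value u))
  ∣∣-square u =
    let x , _ , x²≈Nu = R.root 2 (0<N u)
    in trans (fromℝ-* x x) (fromℝ-cong (R.trans (R.*-congˡ (R.sym (R.*-identityʳ x))) x²≈Nu))

  ∣∣-cong : ∀ {u v} → N (value u) R.≈ N (value v) → value ∣ u ∣ ≈ value ∣ v ∣
  ∣∣-cong {u} {v} Nu≈Nv =
    let x , 0<x , x²≈Nu = R.root 2 (0<N u)
        y , 0<y , y²≈Nv = R.root 2 (0<N v)
    in fromℝ-cong (R.^-injective 2 0<x 0<y (R.trans x²≈Nu (R.trans Nu≈Nv (R.sym y²≈Nv))))

  -- Moduli are compared through `N`, the squared modulus; so after the n-th root of `N u` one more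
  -- square root is taken to reach a positive real representative.
  modulus-divisible : ∀ n .{{_ : NonZero n}} u → ∃[ v ] n ×ˣ v |ℂˣ|.≈ u
  modulus-divisible n u =
    let x , 0<x , xⁿ≈Nu = R.root n (0<N u)
        y , 0<y , y²≈x  = R.root 2 0<x
    in fromℝ⁺ y 0<y
     , R.trans (N-×ˣ n (fromℝ⁺ y 0<y)) (R.trans (R.^-congˡ n
         (R.trans (N-fromℝ y) (R.trans (R.*-congˡ (R.sym (R.*-identityʳ y))) y²≈x))) xⁿ≈Nu)

  modulus-torsionFree : ∀ n .{{_ : NonZero n}} {u v} → n ×ˣ u |ℂˣ|.≈ n ×ˣ v → u |ℂˣ|.≈ v
  modulus-torsionFree n {u} {v} p = R.^-injective n (0<N u) (0<N v)
    (R.trans (R.sym (N-×ˣ n u)) (R.trans p (N-×ˣ n v)))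

  𝕚 : ℂ
  𝕚 = R.0# +i R.1#

  1+𝕚²≈0 : 1# + 𝕚 * 𝕚 ≈ 0#
  1+𝕚²≈0 =
    byRing 0 (#1 ⊕ (#0 ⊗ #0 ⊖ #1 ⊗ #1) ⊜ #0) [] R.refl ,
    byRing 0 (#0 ⊕ (#0 ⊗ #1 ⊕ #1 ⊗ #0) ⊜ #0) [] R.refl

  -- On the unit circle the right side is `1 + z`; multiplying by `1 + z` gives
  -- `(1 + z)² = z |1 + z|²`, the source of the formula for the square root.
  *-conj[1+] : ∀ z → z * conj (1# + z) ≈ fromℝ (N z) + z
  *-conj[1+] (a +i b) =
    byRing 2 (λ a b → a ⊗ (#1 ⊕ a) ⊖ b ⊗ (⊝ (#0 ⊕ b)) ⊜ a ⊗ a ⊕ b ⊗ b ⊕ a) (a ∷ b ∷ []) R.refl ,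
    byRing 2 (λ a b → a ⊗ (⊝ (#0 ⊕ b)) ⊕ b ⊗ (#1 ⊕ a) ⊜ #0 ⊕ b) (a ∷ b ∷ []) R.refl

-- Square roots on the unit circle.

module UnitCircle (em : ExcludedMiddle 0ℓ) (F : CompleteOrderedField) where
  open ComplexNumbers em F
  open Complex F
  open AbelianGroupSolver unitGroup
  open SetoidReasoning setoid
  private
    module +-Properties = AbelianGroupProperties (CommutativeRing.+-abelianGroup commutativeRing)

  -- A square root of z on the unit circle is (1 + z) / |1 + z|, unless z = −1.
  √ : ℂˣ → ℂˣ
  √ u with em {1# + value u ≈ 0#}
  ... | yes _ = unit 𝕚
  ... | no  _ = unit (1# + value u) · ∣ unit (1# + value u) ∣ ⁻¹ˣ

  √-cong : ∀ {u v} → value u ≈ value v → value (√ u) ≈ value (√ v)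
  √-cong {u} {v} u≈v with em {1# + value u ≈ 0#} | em {1# + value v ≈ 0#}
  ... | yes _     | yes _     = refl
  ... | yes 1+u≈0 | no  1+v≉0 = contradiction (trans (+-cong refl (sym u≈v)) 1+u≈0) 1+v≉0
  ... | no  1+u≉0 | yes 1+v≈0 = contradiction (trans (+-cong refl u≈v) 1+v≈0) 1+u≉0
  ... | no  _     | no  _     =
    *-cong w≈w′ (inv-cong {∣ w ∣} {∣ w′ ∣} (∣∣-cong {w} {w′} (N-cong w≈w′)))
    where
    w    = unit (1# + value u)
    w′   = unit (1# + value v)
    w≈w′ = unit-cong (+-cong refl u≈v)

  √-square : ∀ u → ∣ u ∣≈1 → value (√ u · √ u) ≈ value u
  √-square u ∣u∣≈1 with em {1# + value u ≈ 0#}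
  ... | yes 1+u≈0 = trans (*-cong i≈ i≈)
      (+-Properties.∙-cancelˡ 1# _ _ (trans 1+𝕚²≈0 (sym 1+u≈0)))
    where
    i≈ : value (unit 𝕚) ≈ 𝕚
    i≈ = value-unit λ (_ , 1≈0) → R.0≉1 (R.sym 1≈0)
  ... | no 1+u≉0 = modulo ((w · w , u · (∣ w ∣ · ∣ w ∣) , w²≈) ∷ [])
      {w · ∣ w ∣ ⁻¹ˣ · (w · ∣ w ∣ ⁻¹ˣ)} {u}
      (byAbelian 3 (λ u w m → w ⊘ m ⊗ (w ⊘ m) ⊜ u ⊗ (w ⊗ w ⊘ (u ⊗ (m ⊗ m)) ⊗ #1)) (u ∷ w ∷ ∣ w ∣ ∷ []) ≡.refl)
    where
    w = unit (1# + value u)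

    w≈ : value w ≈ 1# + value u
    w≈ = value-unit 1+u≉0

    w²≈ : value (w · w) ≈ value (u · (∣ w ∣ · ∣ w ∣))
    w²≈ = begin
      value w * value w                          ≈⟨ *-cong w≈ w≈ ⟩
      (1# + value u) * (1# + value u)            ≈⟨ *-congʳ (+-cong (fromℝ-cong ∣u∣≈1) refl) ⟨
      (fromℝ (N (value u)) + value u) * (1# + value u)
                                                 ≈⟨ *-congʳ (*-conj[1+] (value u)) ⟨
      value u * conj (1# + value u) * (1# + value u)
                                                 ≈⟨ *-assoc _ _ _ ⟩
      value u * (conj (1# + value u) * (1# + value u))
                                                 ≈⟨ *-congˡ (*-comm _ _) ⟩
      value u * ((1# + value u) * conj (1# + value u))
                                                 ≈⟨ *-congˡ (z*z̄≈N _) ⟩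
      value u * fromℝ (N (1# + value u))         ≈⟨ *-congˡ (fromℝ-cong (N-cong w≈)) ⟨
      value u * fromℝ (N (value w))              ≈⟨ *-congˡ (∣∣-square w) ⟨
      value u * value (∣ w ∣ · ∣ w ∣)            ∎

  ∣√∣≈1 : ∀ u → ∣ u ∣≈1 → ∣ √ u ∣≈1
  ∣√∣≈1 u ∣u∣≈1 = R.^-injective 2 (0<N (√ u)) R.0<1
    (R.trans (R.*-congˡ (R.*-identityʳ _)) (R.trans (R.sym (N-* (value (√ u)) (value (√ u))))
      (R.trans (N-cong (√-square u ∣u∣≈1)) (R.trans ∣u∣≈1 (R.sym (R.1^n≈1 2))))))

-- Sums indexed by the group.

module GroupSum (M : CommutativeMonoid 0ℓ 0ℓ) (𝔾 : FiniteGroup) where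
  open CommutativeMonoid M
  open CommutativeMonoidSum M
  open CommutativeMonoidMult M using () renaming (_×_ to infixr 8 _×′_)
  open FiniteGroup 𝔾 using (order; enumeration; group) renaming (Carrier to G; _∙_ to _∘ᴳ_)
  open Inverse enumeration using (to; from; strictlyInverseˡ; strictlyInverseʳ)
  open GroupProperties group using (\\-leftDividesˡ; \\-leftDividesʳ)
  open Group group using (_\\_)

  ∑ : (G → Carrier) → Carrier
  ∑ f = sum (f ∘ to)

  ∑-cong : ∀ {f g} → (∀ x → f x ≈ g x) → ∑ f ≈ ∑ g
  ∑-cong f≈g = sum-cong-≋ (f≈g ∘ to)

  ∑-∙ : ∀ f g → ∑ (λ x → f x ∙ g x) ≈ ∑ f ∙ ∑ g
  ∑-∙ f g = ∑-distrib-+ (f ∘ to) (g ∘ to)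

  ∑-const : ∀ x → ∑ (λ _ → x) ≈ order ×′ x
  ∑-const x = sum-replicate order

  ∑-translate : ∀ h f → ∑ f ≈ ∑ (f ∘ (h ∘ᴳ_))
  ∑-translate h f = trans (sum-permute (f ∘ to) translation)
    (reflexive (sum-cong-≗ λ i → cong f (strictlyInverseˡ (h ∘ᴳ to i))))
    where
    translation : Fin order ↔ Fin order
    translation = ↔-sym enumeration ↔-∘ (mk↔ₛ′ (h ∘ᴳ_) (h \\_) (\\-leftDividesˡ h) (\\-leftDividesʳ h)
                    ↔-∘ enumeration)

  private
    sum-only : ∀ {n} (f : Fin n → Carrier) i → (∀ j → j ≢ i → f j ≈ ε) → sum f ≈ f i
    sum-only {suc n} f zero f≈ε = trans
      (∙-congˡ (trans (sum-cong-≋ λ j → f≈ε (suc j) λ ()) (sum-replicate-zero n)))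
      (identityʳ (f zero))
    sum-only f (suc i) f≈ε = trans (∙-congʳ (f≈ε zero λ ()))
      (trans (identityˡ _) (sum-only (f ∘ suc) i λ j j≢i → f≈ε (suc j) (j≢i ∘ Fin.suc-injective)))

  ∑-only : ∀ f x → (∀ y → y ≢ x → f y ≈ ε) → ∑ f ≈ f x
  ∑-only f x f≈ε = trans
    (sum-only (f ∘ to) (from x) λ j j≢ → f≈ε (to j) λ to-j≡x →
      j≢ (≡.trans (≡.sym (strictlyInverseʳ j)) (cong from to-j≡x)))
    (reflexive (cong f (strictlyInverseˡ x)))

  ∑-zero : ∀ f → (∀ x → f x ≈ ε) → ∑ f ≈ ε
  ∑-zero f f≈ε = trans (sum-cong-≋ (f≈ε ∘ to)) (sum-replicate-zero order)

-- Left cosets and their representatives.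

module LeftCosets (em : ExcludedMiddle 0ℓ) (𝔾 : FiniteGroup) (H : FiniteGroup.Subgroup 𝔾) where
  open FiniteGroup 𝔾 renaming (Carrier to G)
  open Group group public using (_\\_; assoc; identityˡ; identityʳ; inverseˡ; inverseʳ)
  open GroupProperties group public
    using (\\-leftDividesˡ; \\-leftDividesʳ; ⁻¹-anti-homo-\\; ⁻¹-anti-homo-∙; ⁻¹-involutive)
  open FiniteGroup.Subgroup H public
  open Inverse enumeration using (to; from; strictlyInverseˡ)

  infix 4 _~_

  _~_ : G → G → Set
  x ~ y = x \\ y ∈ member

  \\-∙ : ∀ x y z → (x \\ y) ∙ (y \\ z) ≡ x \\ z
  \\-∙ x y z = ≡.trans (assoc (x ⁻¹) y (y \\ z)) (cong (x ⁻¹ ∙_) (\\-leftDividesˡ y z))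

  ~-refl : ∀ x → x ~ x
  ~-refl x = subst member (≡.sym (inverseˡ x)) ε-closed

  ~-sym : ∀ {x y} → x ~ y → y ~ x
  ~-sym {x} {y} p = subst member (⁻¹-anti-homo-\\ x y) (⁻¹-closed p)

  ~-trans : ∀ {x y z} → x ~ y → y ~ z → x ~ z
  ~-trans {x} {y} {z} p q = subst member (\\-∙ x y z) (∙-closed p q)

  ~-∙ : ∀ x {g} → g ∈ member → x ~ x ∙ g
  ~-∙ x {g} g∈H = subst member (≡.sym (\\-leftDividesʳ x g)) g∈H

  private
    -- The first hit in the enumeration depends only on the extension of `P`, so all elements of a
    -- coset get the same representative. The default `ε` is never reached when some enumerated
    -- element satisfies `P`.
    pick : ∀ {n} → (Fin n → G) → Pred G 0ℓ → G
    pick {zero}  e P = ε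
    pick {suc n} e P with em {P (e zero)}
    ... | yes _ = e zero
    ... | no  _ = pick (e ∘ suc) P

    pick-sound : ∀ {n} (e : Fin n → G) (P : Pred G 0ℓ) i → P (e i) → P (pick e P)
    pick-sound {suc n} e P i p with em {P (e zero)}
    pick-sound {suc n} e P i       p | yes p₀ = p₀
    pick-sound {suc n} e P zero    p | no ¬p₀ = contradiction p ¬p₀
    pick-sound {suc n} e P (suc i) p | no ¬p₀ = pick-sound (e ∘ suc) P i p

    pick-cong : ∀ {n} (e : Fin n → G) (P Q : Pred G 0ℓ) → (∀ {x} → P x → Q x) → (∀ {x} → Q x → P x) →
                pick e P ≡ pick e Q
    pick-cong {zero}  e P Q P⇒Q Q⇒P = ≡.refl
    pick-cong {suc n} e P Q P⇒Q Q⇒P with em {P (e zero)} | em {Q (e zero)}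
    ... | yes _ | yes _ = ≡.refl
    ... | yes p | no ¬q = contradiction (P⇒Q p) ¬q
    ... | no ¬p | yes q = contradiction (Q⇒P q) ¬p
    ... | no _  | no _  = pick-cong (e ∘ suc) P Q P⇒Q Q⇒P

  representative : G → G
  representative x = pick to (_~ x)

  representative-~ : ∀ x → representative x ~ x
  representative-~ x = pick-sound to (_~ x) (from x)
    (subst (_~ x) (≡.sym (strictlyInverseˡ x)) (~-refl x))

  representative-cong : ∀ {x y} → x ~ y → representative x ≡ representative y
  representative-cong {x} {y} x~y = pick-cong to (_~ x) (_~ y)
    (λ z~x → ~-trans z~x x~y) (λ z~y → ~-trans z~y (~-sym x~y))

  -- An H-equivariant retraction of G onto H, for left multiplication.
  retract : G → G
  retract k = k ∙ representative (k ⁻¹)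

  retract-∈ : ∀ k → retract k ∈ member
  retract-∈ k = subst (λ x → x ∙ representative (k ⁻¹) ∈ member) (⁻¹-involutive k)
    (~-sym (representative-~ (k ⁻¹)))

  -- The inverse `(h k)⁻¹ = k⁻¹h⁻¹` lies in the left coset of `k⁻¹`, so both have the same
  -- representative.
  retract-∙ : ∀ {h} → h ∈ member → ∀ k → retract (h ∙ k) ≡ h ∙ retract k
  retract-∙ {h} h∈H k = ≡.trans (assoc h k _) (cong (λ r → h ∙ (k ∙ r)) (≡.sym (representative-cong
    (subst (k ⁻¹ ~_) (≡.sym (⁻¹-anti-homo-∙ h k)) (~-∙ (k ⁻¹) (⁻¹-closed h∈H))))))

-- Vanishing of first and second cohomology.

-- Averaging over the group: multiplication by its order is invertible on a
-- uniquely divisible group of coefficients.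
module UniquelyDivisible
  (em : ExcludedMiddle 0ℓ) (𝔾 : FiniteGroup) (H : FiniteGroup.Subgroup 𝔾) (A : AbelianGroup 0ℓ 0ℓ)
  (divisible : ∀ n .{{_ : NonZero n}} (u : AbelianGroup.Carrier A) →
    ∃[ v ] AbelianGroup._≈_ A (multiple (AbelianGroup.rawMonoid A) n v) u)
  (torsionFree : ∀ n .{{_ : NonZero n}} {u v : AbelianGroup.Carrier A} →
    AbelianGroup._≈_ A (multiple (AbelianGroup.rawMonoid A) n u) (multiple (AbelianGroup.rawMonoid A) n v) →
    AbelianGroup._≈_ A u v)
  where
  open AbelianGroup A
    using (_≈_; refl; reflexive; sym; trans; setoid; commutativeMonoid)
    renaming ( Carrier to |A|; _∙_ to infixl 6 _+_; ε to 0#; ∙-cong to +-cong; ∙-congʳ to +-congʳ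
             ; identityˡ to +-identityˡ)
  open AbelianGroupProperties A using (∙-cancelʳ)
  open GroupSum commutativeMonoid 𝔾
  open CommutativeMonoidMult commutativeMonoid using (×-distrib-+) renaming (_×_ to infixr 8 _×′_)
  open FiniteGroup 𝔾 using (order; enumeration; _∙_; ε) renaming (Carrier to G)
  open LeftCosets em 𝔾 H using (member; retract; retract-∈; retract-∙)
  open SetoidReasoning setoid

  private instance
    order-nonZero : NonZero order
    order-nonZero = Fin.nonZeroIndex (Inverse.from enumeration ε)

  -- Summing over `G` through `retract` replaces a sum over `H`: by equivariance, translation by an
  -- element of `H` becomes translation of the index in `G`.
  ∑-retract : ∀ {h} → h ∈ member → (f : G → |A|) →
              ∑ (λ k → f (h ∙ retract k)) ≈ ∑ (λ k → f (retract k))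
  ∑-retract {h} h∈H f = trans
    (∑-cong λ k → reflexive (cong f (≡.sym (retract-∙ h∈H k))))
    (sym (∑-translate h (f ∘ retract)))

  -- Adding `χ g` to every term of the sum of `χ` amounts to translating the index by `g`, which
  -- leaves the sum unchanged; hence `order` times `χ g` vanishes.
  H¹-trivial : (χ : G → |A|) → (∀ {g h} → g ∈ member → h ∈ member → χ (g ∙ h) ≈ χ g + χ h) →
               ∀ {g} → g ∈ member → χ g ≈ 0#
  H¹-trivial χ hom {g} g∈H = torsionFree order (begin
    order ×′ χ g              ≈⟨ ∙-cancelʳ (∑ (χ ∘ retract)) _ _ (begin
      order ×′ χ g + ∑ (χ ∘ retract)       ≈⟨ +-congʳ (∑-const (χ g)) ⟨
      ∑ (λ _ → χ g) + ∑ (χ ∘ retract)      ≈⟨ ∑-∙ (λ _ → χ g) (χ ∘ retract) ⟨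
      ∑ (λ k → χ g + χ (retract k))        ≈⟨ ∑-cong (λ k → hom g∈H (retract-∈ k)) ⟨
      ∑ (λ k → χ (g ∙ retract k))          ≈⟨ ∑-retract g∈H χ ⟩
      ∑ (χ ∘ retract)                      ≈⟨ +-identityˡ _ ⟨
      0# + ∑ (χ ∘ retract)                 ∎) ⟩
    0#                        ≈⟨ ∑-zero (λ _ → 0#) (λ _ → refl) ⟨
    ∑ (λ _ → 0#)              ≈⟨ ∑-const 0# ⟩
    order ×′ 0#               ∎)

  -- Summing the cocycle identity over its last argument exhibits `order` times `α` as the
  -- coboundary of `δ g`, the sum of `α g` over its second argument. Dividing by the order gives
  -- `γ`.
  H²-trivial : (α : G → G → |A|) →
               (∀ {g h k} → g ∈ member → h ∈ member → k ∈ member →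
                 α g h + α (g ∙ h) k ≈ α g (h ∙ k) + α h k) →
               Σ[ γ ∈ (G → |A|) ] (∀ {g h} → g ∈ member → h ∈ member →
                 α g h + γ (g ∙ h) ≈ γ g + γ h)
  H²-trivial α cocycle = γ , λ {g} {h} g∈H h∈H → torsionFree order (begin
    order ×′ (α g h + γ (g ∙ h))            ≈⟨ ×-distrib-+ _ _ order ⟩
    order ×′ α g h + order ×′ γ (g ∙ h)     ≈⟨ +-cong (sym (∑-const (α g h))) (order×γ (g ∙ h)) ⟩
    ∑ (λ _ → α g h) + δ (g ∙ h)             ≈⟨ ∑-∙ (λ _ → α g h) (λ k → α (g ∙ h) (retract k)) ⟨
    ∑ (λ k → α g h + α (g ∙ h) (retract k)) ≈⟨ ∑-cong (λ k → cocycle g∈H h∈H (retract-∈ k)) ⟩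
    ∑ (λ k → α g (h ∙ retract k) + α h (retract k))
                                            ≈⟨ ∑-∙ (λ k → α g (h ∙ retract k)) (λ k → α h (retract k)) ⟩
    ∑ (λ k → α g (h ∙ retract k)) + δ h     ≈⟨ +-congʳ (∑-retract h∈H (α g)) ⟩
    δ g + δ h                               ≈⟨ +-cong (order×γ g) (order×γ h) ⟨
    order ×′ γ g + order ×′ γ h             ≈⟨ ×-distrib-+ _ _ order ⟨
    order ×′ (γ g + γ h)                    ∎)
    where
    δ γ : G → |A|
    δ g = ∑ (λ k → α g (retract k))
    γ g = proj₁ (divisible order (δ g))

    order×γ : ∀ g → order ×′ γ g ≈ δ g
    order×γ g = proj₂ (divisible order (δ g))

-- Matrix operations entry by entry.

module Matrices (em : ExcludedMiddle 0ℓ) (F : CompleteOrderedField) (𝔾 : FiniteGroup) where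
  open Weights F 𝔾
  open Complex F
  open ComplexNumbers em F
  open GroupSum +-commutativeMonoid 𝔾 using (∑-cong; ∑-only; ∑-zero)
  open FiniteGroup 𝔾 renaming (Carrier to G)
  open Group group using (_\\_; identityˡ)
  open GroupProperties group using (\\-leftDividesˡ; \\-leftDividesʳ)
  open SetoidReasoning setoid

  if-true : ∀ {P : Set} (d : Dec P) {z w : ℂ} → P → (if does d then z else w) ≈ z
  if-true d {z} {w} p rewrite dec-true d p = refl

  if-false : ∀ {P : Set} (d : Dec P) {z w : ℂ} → ¬ P → (if does d then z else w) ≈ w
  if-false d {z} {w} ¬p rewrite dec-false d ¬p = refl

  *-vanishˡ : ∀ {z w} → z ≈ 0# → z * w ≈ 0#
  *-vanishˡ z≈0 = trans (*-congʳ z≈0) (zeroˡ _)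

  *-vanishʳ : ∀ {z w} → w ≈ 0# → z * w ≈ 0#
  *-vanishʳ w≈0 = trans (*-congˡ w≈0) (zeroʳ _)

  -- Exactly one `A g` is nonzero at `(x, y)`, namely the one with `g = x⁻¹y`.
  linComb-at : ∀ k W x y → linComb k A[ W ] x y ≈ k (x \\ y) * W x y
  linComb-at k W x y = trans
    (∑-only (λ g → k g * (A g x y * W x y)) (x \\ y) λ g g≢ →
      *-vanishʳ (*-vanishˡ (if-false (x ∙ g ≟ y) λ x∙g≡y →
        g≢ (≡.trans (≡.sym (\\-leftDividesʳ x g)) (cong (x \\_) x∙g≡y)))))
    (*-congˡ (trans (*-congʳ (if-true (x ∙ (x \\ y) ≟ y) (\\-leftDividesˡ x y))) (*-identityˡ _)))

  inSpan-at : ∀ {W M} (p : InSpan W M) x y → M x y ≈ proj₁ p (x \\ y) * W x y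
  inSpan-at {W} (k , M≋) x y = trans (M≋ x y) (linComb-at k W x y)

  diag-⊛ : ∀ a M x y → (diag a ⊛ M) x y ≈ a x * M x y
  diag-⊛ a M x y = trans
    (∑-only (λ z → diag a x z * M z y) x λ z z≢x → *-vanishˡ (if-false (x ≟ z) (z≢x ∘ ≡.sym)))
    (*-congʳ (if-true (x ≟ x) ≡.refl))

  ⊛-diag : ∀ M a x y → (M ⊛ diag a) x y ≈ M x y * a y
  ⊛-diag M a x y = trans
    (∑-only (λ z → M x z * diag a z y) y λ z z≢y → *-vanishʳ (if-false (z ≟ y) z≢y))
    (*-congˡ (if-true (y ≟ y) ≡.refl))

  ⊛-permMatrix : ∀ M (σ : G ↔ G) x y → (M ⊛ permMatrix (Inverse.to σ)) x y ≈ M x (Inverse.from σ y)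
  ⊛-permMatrix M σ x y = trans
    (∑-only (λ z → M x z * permMatrix to z y) (from y) λ z z≢ →
      *-vanishʳ (if-false (to z ≟ y) λ to-z≡y →
        z≢ (≡.trans (≡.sym (strictlyInverseʳ z)) (cong from to-z≡y))))
    (trans (*-congˡ (if-true (to (from y) ≟ y) (strictlyInverseˡ y))) (*-identityʳ _))
    where open Inverse σ

  ⊛-congʳ : ∀ N {M M′} → M ≋ M′ → M ⊛ N ≋ M′ ⊛ N
  ⊛-congʳ N p x y = ∑-cong λ z → *-congʳ {N z y} (p x z)

  module _ (s : Aut) where
    open Aut s using (σ; preserves)
    open Inverse σ using (to; from)

    from-\\ : ∀ x y → from x \\ from y ≡ x \\ y
    from-\\ x y with proj₂ (preserves (x \\ y)) (\\-leftDividesˡ x y)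
    -- With `g = x⁻¹y`, the pair `(x, y)` of `c g` is the image of a pair `(u, v)` of `c g`, and
    -- that pair can only be `(from x, from y)`.
    ... | u , v , u∙g≡v , ≡.refl , ≡.refl = ≡.trans
      (cong₂ _\\_ (Inverse.strictlyInverseʳ σ u) (≡.trans (Inverse.strictlyInverseʳ σ v) (≡.sym u∙g≡v)))
      (\\-leftDividesʳ u (to u \\ to v))

    transform-at : ∀ a γ W x y → transform a γ s W x y ≈
                   inv (a x) * (value (γ (x \\ y)) * W (from x) (from y)) * value (a y)
    transform-at a γ W x y = begin
      (D⁻¹ ⊛ P⁻¹ ⊛ L ⊛ P ⊛ diag (value ∘ a)) x y   ≈⟨ ⊛-diag (D⁻¹ ⊛ P⁻¹ ⊛ L ⊛ P) (value ∘ a) x y ⟩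
      (D⁻¹ ⊛ P⁻¹ ⊛ L ⊛ P) x y * value (a y)        ≈⟨ *-congʳ (⊛-permMatrix (D⁻¹ ⊛ P⁻¹ ⊛ L) σ x y) ⟩
      (D⁻¹ ⊛ P⁻¹ ⊛ L) x (from y) * value (a y)     ≈⟨ *-congʳ (⊛-congʳ L (diag-⊛ (inv ∘ a) P⁻¹) x (from y)) ⟩
      (D⁻¹P⁻¹ ⊛ L) x (from y) * value (a y)        ≈⟨ *-congʳ (∑-only (λ z → D⁻¹P⁻¹ x z * L z (from y)) (from x)
                                                        λ z z≢ → *-vanishˡ (*-vanishʳ (if-false (from x ≟ z) (z≢ ∘ ≡.sym)))) ⟩
      D⁻¹P⁻¹ x (from x) * L (from x) (from y) * value (a y)
        ≈⟨ *-congʳ (*-cong (trans (*-congˡ (if-true (from x ≟ from x) ≡.refl)) (*-identityʳ _))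
             (trans (linComb-at (value ∘ γ) W (from x) (from y))
               (*-congʳ (reflexive (cong (value ∘ γ) (from-\\ x y)))))) ⟩
      inv (a x) * (value (γ (x \\ y)) * W (from x) (from y)) * value (a y) ∎
      where
      open Aut s using (P; P⁻¹)
      L D⁻¹ D⁻¹P⁻¹ : Matrix
      L          = linComb (value ∘ γ) A[ W ]
      D⁻¹        = diag (inv ∘ a)
      D⁻¹P⁻¹ x z = inv (a x) * P⁻¹ x z

  idAut : Aut
  idAut = record
    { σ         = mk↔ₛ′ (λ x → x) (λ x → x) (λ _ → ≡.refl) (λ _ → ≡.refl)
    ; preserves = λ g → (λ { (_ , _ , p , ≡.refl , ≡.refl) → p }) , λ p → _ , _ , p , ≡.refl , ≡.refl
    }

  A-⊛-A : ∀ W g h x y → y ≡ x ∙ g ∙ h → (A[ W ] g ⊛ A[ W ] h) x y ≈ W x (x ∙ g) * W (x ∙ g) y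
  A-⊛-A W g h x y y≡xgh = trans
    (∑-only (λ z → A[ W ] g x z * A[ W ] h z y) (x ∙ g) λ z z≢ →
      *-vanishˡ (*-vanishˡ (if-false (x ∙ g ≟ z) (z≢ ∘ ≡.sym))))
    (*-cong (trans (*-congʳ (if-true (x ∙ g ≟ x ∙ g) ≡.refl)) (*-identityˡ _))
            (trans (*-congʳ (if-true (x ∙ g ∙ h ≟ y) (≡.sym y≡xgh))) (*-identityˡ _)))

  A-⊛-A-off : ∀ W g h x y → y ≢ x ∙ g ∙ h → (A[ W ] g ⊛ A[ W ] h) x y ≈ 0#
  A-⊛-A-off W g h x y y≢xgh = ∑-zero (λ z → A[ W ] g x z * A[ W ] h z y) vanish
    where
    vanish : ∀ z → A[ W ] g x z * A[ W ] h z y ≈ 0#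
    vanish z with x ∙ g ≟ z
    ... | no  x∙g≢z  = *-vanishˡ (*-vanishˡ (if-false (x ∙ g ≟ z) x∙g≢z))
    ... | yes ≡.refl = *-vanishʳ (*-vanishˡ (if-false (x ∙ g ∙ h ≟ y) (y≢xgh ∘ ≡.sym)))

  A-inSpan : ∀ W g → InSpan W (A[ W ] g)
  -- The row of `ε` in `A g` is the indicator function of `g`.
  A-inSpan W g = A g ε , λ x y → trans (*-congʳ (A-\\ x y)) (sym (linComb-at (A g ε) W x y))
    where
    A-\\ : ∀ x y → A g x y ≈ A g ε (x \\ y)
    A-\\ x y with x ∙ g ≟ y
    ... | yes ≡.refl = trans (if-true (x ∙ g ≟ x ∙ g) ≡.refl)
      (sym (if-true (ε ∙ g ≟ x \\ (x ∙ g)) (≡.trans (identityˡ g) (≡.sym (\\-leftDividesʳ x g)))))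
    ... | no  x∙g≢y  = trans (if-false (x ∙ g ≟ y) x∙g≢y) (sym (if-false (ε ∙ g ≟ x \\ y) λ g≡x\\y →
      x∙g≢y (≡.trans (cong (x ∙_) (≡.trans (≡.sym (identityˡ g)) g≡x\\y)) (\\-leftDividesˡ x y))))

-- Multiplication laws and cocycles.

module _ (𝔾 : FiniteGroup) where
  open FiniteGroup 𝔾 using (_∙_) renaming (Carrier to G)

  -- Opaque, since unfolding products of complex numbers is exponential.
  opaque
    twist : {A : Set} (_·_ : A → A → A) (_⁻¹ : A → A) (α : G → G → A) (γ : G → A) → G → G → A
    twist _·_ _⁻¹ α γ g h = α g h · ((γ g · γ h) · (γ (g ∙ h) ⁻¹))

-- The multiplication law of a monomial algebra, stated on points: the
-- entries of W on three points of a left coset of H determine α.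
module MultiplicationLaw (em : ExcludedMiddle 0ℓ) (𝔾 : FiniteGroup) (H : FiniteGroup.Subgroup 𝔾)
                         (A : AbelianGroup 0ℓ 0ℓ) where
  open AbelianGroup A
    using (_≈_; reflexive; sym; trans; ∙-congˡ; ∙-congʳ; comm)
    renaming (Carrier to |A|; _∙_ to infixl 7 _·_; ε to ε′; _⁻¹ to infix 8 _⁻¹ᴬ)
  open AbelianGroupProperties A using (∙-cancelˡ; ∙-cancelʳ)
  open AbelianGroupSolver A
  open FiniteGroup 𝔾 renaming (Carrier to G)
  open LeftCosets em 𝔾 H

  Law : (ω α : G → G → |A|) → Set
  Law ω α = ∀ {x y z} → x ~ y → y ~ z → ω x y · ω y z ≈ α (x \\ y) (y \\ z) · ω x z

  Cocycle : (α : G → G → |A|) → Set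
  Cocycle α = ∀ {g h k} → g ∈ member → h ∈ member → k ∈ member →
              α g h · α (g ∙ h) k ≈ α g (h ∙ k) · α h k

  infix 4 _/_≈δ_

  _/_≈δ_ : (α β : G → G → |A|) (γ : G → |A|) → Set
  α / β ≈δ γ = ∀ {g h} → g ∈ member → h ∈ member →
               α g h · β g h ⁻¹ᴬ ≈ γ g · γ h · γ (g ∙ h) ⁻¹ᴬ

  ε\\ : ∀ g → ε \\ g ≡ g
  ε\\ g = ≡.trans (cong (ε \\_) (≡.sym (identityˡ g))) (\\-leftDividesʳ ε g)

  ε~ : ∀ {g} → g ∈ member → ε ~ g
  ε~ {g} = subst member (≡.sym (ε\\ g))

  -- Both sides are the factor between `ω w x · ω x y · ω y z` and `ω w z`, computed with the two
  -- bracketings, at the points `ε`, `g`, `g h`, `g h k`.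
  law⇒cocycle : ∀ {ω α} → Law ω α → Cocycle α
  law⇒cocycle {ω} {α} law {g} {h} {k} g∈H h∈H k∈H =
    subst₅ (onPoints (ε~ g∈H) (~-∙ g h∈H) (~-∙ (g ∙ h) k∈H))
    where
    onPoints : ∀ {w x y z} → w ~ x → x ~ y → y ~ z →
               α (w \\ x) (x \\ y) · α (w \\ y) (y \\ z) ≈ α (w \\ x) (x \\ z) · α (x \\ y) (y \\ z)
    onPoints {w} {x} {y} {z} w~x x~y y~z = modulo
      ( (α (w \\ x) (x \\ y) · ω w y , ω w x · ω x y , sym (law w~x x~y))
      ∷ (α (w \\ y) (y \\ z) · ω w z , ω w y · ω y z , sym (law (~-trans w~x x~y) y~z))
      ∷ (ω x y · ω y z , α (x \\ y) (y \\ z) · ω x z , law x~y y~z)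
      ∷ (ω w x · ω x z , α (w \\ x) (x \\ z) · ω w z , law w~x (~-trans x~y y~z))
      ∷ [])
      {α (w \\ x) (x \\ y) · α (w \\ y) (y \\ z)} {α (w \\ x) (x \\ z) · α (x \\ y) (y \\ z)}
      (byAbelian 10 (λ wx xy yz wy xz wz a b c d →
        a ⊗ b ⊜ d ⊗ c ⊗ (a ⊗ wy ⊘ (wx ⊗ xy) ⊗ (b ⊗ wz ⊘ (wy ⊗ yz) ⊗
                         (xy ⊗ yz ⊘ (c ⊗ xz) ⊗ (wx ⊗ xz ⊘ (d ⊗ wz) ⊗ #1)))))
        (ω w x ∷ ω x y ∷ ω y z ∷ ω w y ∷ ω x z ∷ ω w z ∷ α (w \\ x) (x \\ y) ∷ α (w \\ y) (y \\ z)
          ∷ α (x \\ y) (y \\ z) ∷ α (w \\ x) (x \\ z) ∷ []) ≡.refl)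

    subst₅ : α (ε \\ g) (g \\ (g ∙ h)) · α (ε \\ (g ∙ h)) ((g ∙ h) \\ (g ∙ h ∙ k)) ≈
             α (ε \\ g) (g \\ (g ∙ h ∙ k)) · α (g \\ (g ∙ h)) ((g ∙ h) \\ (g ∙ h ∙ k)) →
             α g h · α (g ∙ h) k ≈ α g (h ∙ k) · α h k
    subst₅ rewrite ε\\ g | ε\\ (g ∙ h) | assoc g h k | \\-leftDividesʳ g h | \\-leftDividesʳ g (h ∙ k)
                 | ≡.sym (assoc g h k) | \\-leftDividesʳ (g ∙ h) k = λ p → p

  -- Diagonal similarity, rescaling and translation by t change α by δγ.
  law-transform : ∀ {ω α ω′ α′} (a γ : G → |A|) (t : G → G) → (∀ x y → t x \\ t y ≡ x \\ y) →
                  Law ω α → Law ω′ α′ →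
                  (∀ {x y} → x ~ y → ω′ x y ≈ a x ⁻¹ᴬ · (γ (x \\ y) · ω (t x) (t y)) · a y) →
                  α′ / α ≈δ γ
  law-transform {ω} {α} {ω′} {α′} a γ t t-\\ law law′ ω′≈ {g} {h} g∈H h∈H =
    subst₃ (onPoints (ε~ g∈H) (~-∙ g h∈H))
    where
    onPoints : ∀ {x y z} → x ~ y → y ~ z → α′ (x \\ y) (y \\ z) · α (x \\ y) (y \\ z) ⁻¹ᴬ ≈
               γ (x \\ y) · γ (y \\ z) · γ (x \\ z) ⁻¹ᴬ
    onPoints {x} {y} {z} x~y y~z = modulo
      ( (α′ (x \\ y) (y \\ z) · ω′ x z , ω′ x y · ω′ y z , sym (law′ x~y y~z))
      ∷ (ω (t x) (t y) · ω (t y) (t z) , α (x \\ y) (y \\ z) · ω (t x) (t z) , law-t)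
      ∷ (ω′ x y , transformed x y , ω′≈ x~y)
      ∷ (ω′ y z , transformed y z , ω′≈ y~z)
      ∷ (transformed x z , ω′ x z , sym (ω′≈ (~-trans x~y y~z)))
      ∷ [])
      {α′ (x \\ y) (y \\ z) · α (x \\ y) (y \\ z) ⁻¹ᴬ} {γ (x \\ y) · γ (y \\ z) · γ (x \\ z) ⁻¹ᴬ}
      (byAbelian 14 (λ xy yz xz xy′ yz′ xz′ a a′ x y z γxy γyz γxz →
        a′ ⊘ a ⊜ γxy ⊗ γyz ⊘ γxz ⊗ (a′ ⊗ xz′ ⊘ (xy′ ⊗ yz′) ⊗ (xy ⊗ yz ⊘ (a ⊗ xz) ⊗
          (xy′ ⊘ (recip x ⊗ (γxy ⊗ xy) ⊗ y) ⊗ (yz′ ⊘ (recip y ⊗ (γyz ⊗ yz) ⊗ z) ⊗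
          (recip x ⊗ (γxz ⊗ xz) ⊗ z ⊘ xz′ ⊗ #1))))))
        (ω (t x) (t y) ∷ ω (t y) (t z) ∷ ω (t x) (t z) ∷ ω′ x y ∷ ω′ y z ∷ ω′ x z
          ∷ α (x \\ y) (y \\ z) ∷ α′ (x \\ y) (y \\ z) ∷ a x ∷ a y ∷ a z
          ∷ γ (x \\ y) ∷ γ (y \\ z) ∷ γ (x \\ z) ∷ []) ≡.refl)
      where
      transformed : G → G → |A|
      transformed x y = a x ⁻¹ᴬ · (γ (x \\ y) · ω (t x) (t y)) · a y

      law-t : ω (t x) (t y) · ω (t y) (t z) ≈ α (x \\ y) (y \\ z) · ω (t x) (t z)
      law-t = subst₂-law (t-\\ x y) (t-\\ y z) (law (subst member (≡.sym (t-\\ x y)) x~y)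
                                                    (subst member (≡.sym (t-\\ y z)) y~z))
        where
        subst₂-law : ∀ {g g′ h h′} → g ≡ g′ → h ≡ h′ →
                     ω (t x) (t y) · ω (t y) (t z) ≈ α g h · ω (t x) (t z) →
                     ω (t x) (t y) · ω (t y) (t z) ≈ α g′ h′ · ω (t x) (t z)
        subst₂-law ≡.refl ≡.refl p = p

    subst₃ : α′ (ε \\ g) (g \\ (g ∙ h)) · α (ε \\ g) (g \\ (g ∙ h)) ⁻¹ᴬ ≈
             γ (ε \\ g) · γ (g \\ (g ∙ h)) · γ (ε \\ (g ∙ h)) ⁻¹ᴬ →
             α′ g h · α g h ⁻¹ᴬ ≈ γ g · γ h · γ (g ∙ h) ⁻¹ᴬ
    subst₃ rewrite ε\\ g | ε\\ (g ∙ h) | \\-leftDividesʳ g h = λ p → p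

  -- Conversely, ω′ / (γ ω) is multiplicative along each left coset, hence
  -- a quotient of its values at the coset representative.
  module _ {ω α ω′ α′ : G → G → |A|} (γ : G → |A|)
           (law : Law ω α) (law′ : Law ω′ α′) (α′/α≈δγ : α′ / α ≈δ γ) where

    scaling : G → |A|
    scaling x = ω′ (representative x) x · (γ (representative x \\ x) · ω (representative x) x) ⁻¹ᴬ

    scaling-≈ : ∀ {x y} → x ~ y → ω′ x y ≈ scaling x ⁻¹ᴬ · (γ (x \\ y) · ω x y) · scaling y
    -- After the rewrite both scalings are measured from the same point `p`, and the two laws can be
    -- compared along `p`, `x`, `y`.
    scaling-≈ {x} {y} x~y rewrite ≡.sym (representative-cong x~y) = modulo
      ( (ω′ p x · ω′ x y , α′ (p \\ x) (x \\ y) · ω′ p y , law′ p~x x~y)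
      ∷ (α (p \\ x) (x \\ y) · ω p y , ω p x · ω x y , sym (law p~x x~y))
      ∷ (α′ (p \\ x) (x \\ y) · α (p \\ x) (x \\ y) ⁻¹ᴬ , γ (p \\ x) · γ (x \\ y) · γ (p \\ y) ⁻¹ᴬ , coboundary)
      ∷ [])
      {ω′ x y} {(ω′ p x · (γ (p \\ x) · ω p x) ⁻¹ᴬ) ⁻¹ᴬ · (γ (x \\ y) · ω x y) · (ω′ p y · (γ (p \\ y) · ω p y) ⁻¹ᴬ)}
      (byAbelian 11 (λ px xy py px′ xy′ py′ a a′ γpx γxy γpy →
        xy′ ⊜ recip (px′ ⊘ (γpx ⊗ px)) ⊗ (γxy ⊗ xy) ⊗ (py′ ⊘ (γpy ⊗ py)) ⊗
              (px′ ⊗ xy′ ⊘ (a′ ⊗ py′) ⊗ (a ⊗ py ⊘ (px ⊗ xy) ⊗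
              (a′ ⊘ a ⊘ (γpx ⊗ γxy ⊘ γpy) ⊗ #1))))
        (ω p x ∷ ω x y ∷ ω p y ∷ ω′ p x ∷ ω′ x y ∷ ω′ p y ∷ α (p \\ x) (x \\ y) ∷ α′ (p \\ x) (x \\ y)
          ∷ γ (p \\ x) ∷ γ (x \\ y) ∷ γ (p \\ y) ∷ []) ≡.refl)
      where
      p   = representative x
      p~x = representative-~ x

      coboundary : α′ (p \\ x) (x \\ y) · α (p \\ x) (x \\ y) ⁻¹ᴬ ≈ γ (p \\ x) · γ (x \\ y) · γ (p \\ y) ⁻¹ᴬ
      coboundary = subst (λ g → α′ (p \\ x) (x \\ y) · α (p \\ x) (x \\ y) ⁻¹ᴬ ≈ γ (p \\ x) · γ (x \\ y) · γ g ⁻¹ᴬ)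
        (\\-∙ p x y) (α′/α≈δγ p~x x~y)

  cocycle-onPoints : ∀ {α} → Cocycle α → ∀ {w x y z} → w ~ x → x ~ y → y ~ z →
    α (w \\ x) (x \\ y) · α (w \\ y) (y \\ z) ≈ α (w \\ x) (x \\ z) · α (x \\ y) (y \\ z)
  cocycle-onPoints {α} cocycle {w} {x} {y} {z} w~x x~y y~z =
    subst₂ (\\-∙ w x y) (\\-∙ x y z) (cocycle w~x x~y y~z)
    where
    subst₂ : ∀ {g g′ h h′} → g ≡ g′ → h ≡ h′ →
             α (w \\ x) (x \\ y) · α g (y \\ z) ≈ α (w \\ x) h · α (x \\ y) (y \\ z) →
             α (w \\ x) (x \\ y) · α g′ (y \\ z) ≈ α (w \\ x) h′ · α (x \\ y) (y \\ z)
    subst₂ ≡.refl ≡.refl p = p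

  module _ {α : G → G → |A|} (cocycle : Cocycle α) where

    cocycle-εˡ : ∀ {g} → g ∈ member → α ε g ≈ α ε ε
    cocycle-εˡ {g} g∈H = sym (∙-cancelʳ (α ε g) _ _
      (subst₂ (identityˡ ε) (identityˡ g) (cocycle ε-closed ε-closed g∈H)))
      where
      subst₂ : ∀ {h k} → h ≡ ε → k ≡ g → α ε ε · α h g ≈ α ε k · α ε g → α ε ε · α ε g ≈ α ε g · α ε g
      subst₂ ≡.refl ≡.refl p = p

    cocycle-εʳ : ∀ {g} → g ∈ member → α g ε ≈ α ε ε
    cocycle-εʳ {g} g∈H = ∙-cancelˡ (α g ε) _ _
      (subst₂ (identityʳ g) (identityˡ ε) (cocycle g∈H ε-closed ε-closed))
      where
      subst₂ : ∀ {h k} → h ≡ g → k ≡ ε → α g ε · α h ε ≈ α g k · α ε ε → α g ε · α g ε ≈ α g ε · α ε ε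
      subst₂ ≡.refl ≡.refl p = p

    -- The cocycle identity at `g`, `g⁻¹`, `g`, in which the other two factors both equal `α ε ε`.
    -- It makes the square roots chosen for `g` and `g⁻¹` agree.
    cocycle-⁻¹ : ∀ {g} → g ∈ member → α (g ⁻¹) g ≈ α g (g ⁻¹)
    cocycle-⁻¹ {g} g∈H = sym (∙-cancelʳ (α ε ε) _ _ (trans (∙-congˡ (sym (cocycle-εˡ g∈H)))
      (trans (subst₂ (inverseʳ g) (inverseˡ g) (cocycle g∈H (⁻¹-closed g∈H) g∈H))
        (trans (∙-congʳ (cocycle-εʳ g∈H)) (comm _ _)))))
      where
      subst₂ : ∀ {h k} → h ≡ ε → k ≡ ε → α g (g ⁻¹) · α h g ≈ α g k · α (g ⁻¹) g →
               α g (g ⁻¹) · α ε g ≈ α g ε · α (g ⁻¹) g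
      subst₂ ≡.refl ≡.refl p = p

  opaque
    unfolding twist

    twist-cocycle : ∀ {α : G → G → |A|} (γ : G → |A|) → Cocycle α → Cocycle (twist 𝔾 _·_ _⁻¹ᴬ α γ)
    twist-cocycle {α} γ cocycle {g} {h} {k} g∈H h∈H k∈H = modulo
      ((α g h · α (g ∙ h) k , α g (h ∙ k) · α h k , cocycle g∈H h∈H k∈H) ∷ [])
      (trans (byAbelian 10 (λ a b c d x y z xy yz xyz →
          a ⊗ (x ⊗ y ⊘ xy) ⊗ (b ⊗ (xy ⊗ z ⊘ xyz)) ⊜
          c ⊗ (x ⊗ yz ⊘ xyz) ⊗ (d ⊗ (y ⊗ z ⊘ yz)) ⊗ (a ⊗ b ⊘ (c ⊗ d) ⊗ #1))
        (α g h ∷ α (g ∙ h) k ∷ α g (h ∙ k) ∷ α h k ∷ γ g ∷ γ h ∷ γ k ∷ γ (g ∙ h) ∷ γ (h ∙ k) ∷ γ (g ∙ h ∙ k) ∷ []) ≡.refl)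
        (reflexive (cong (λ u → α g (h ∙ k) · (γ g · γ (h ∙ k) · γ u ⁻¹ᴬ) · (α h k · (γ h · γ k · γ (h ∙ k) ⁻¹ᴬ))
                                  · (α g h · α (g ∙ h) k · (α g (h ∙ k) · α h k) ⁻¹ᴬ · ε′)) (assoc g h k))))

    twist-trivial : ∀ {α : G → G → |A|} {γ : G → |A|} g h → α g h · γ (g ∙ h) ≈ γ g · γ h →
                    twist 𝔾 _·_ _⁻¹ᴬ α (λ g → γ g ⁻¹ᴬ) g h ≈ ε′
    twist-trivial {α} {γ} g h p = modulo ((α g h · γ (g ∙ h) , γ g · γ h , p) ∷ [])
      (byAbelian 4 (λ a x y xy → a ⊗ (recip x ⊗ recip y ⊘ recip xy) ⊜ #1 ⊗ (a ⊗ xy ⊘ (x ⊗ y) ⊗ #1))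
        (α g h ∷ γ g ∷ γ h ∷ γ (g ∙ h) ∷ []) ≡.refl)

    twist-twist : ∀ {α : G → G → |A|} (γ γ′ : G → |A|) g h →
      twist 𝔾 _·_ _⁻¹ᴬ (twist 𝔾 _·_ _⁻¹ᴬ α γ) γ′ g h · α g h ⁻¹ᴬ ≈
      γ g · γ′ g · (γ h · γ′ h) · (γ (g ∙ h) · γ′ (g ∙ h)) ⁻¹ᴬ
    twist-twist {α} γ γ′ g h = byAbelian 7 (λ a x y z x′ y′ z′ →
        a ⊗ (x ⊗ y ⊘ z) ⊗ (x′ ⊗ y′ ⊘ z′) ⊘ a ⊜ x ⊗ x′ ⊗ (y ⊗ y′) ⊘ (z ⊗ z′))
      (α g h ∷ γ g ∷ γ h ∷ γ (g ∙ h) ∷ γ′ g ∷ γ′ h ∷ γ′ (g ∙ h) ∷ []) ≡.refl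

    -- The factor γ ε compensates for γ (g g⁻¹) in the coboundary of γ.
    twist-normal : ∀ {α : G → G → |A|} {γ : G → |A|} g → γ (g ⁻¹) ≈ γ g → γ g · γ g · α g (g ⁻¹) ≈ ε′ →
                   twist 𝔾 _·_ _⁻¹ᴬ α (λ g → γ g · γ ε) g (g ⁻¹) ≈ ε′
    twist-normal {α} {γ} g γg⁻¹≈γg γ²α≈1 = modulo
      ((γ (g ⁻¹) , γ g , γg⁻¹≈γg) ∷ (γ g · γ g · α g (g ⁻¹) , ε′ , γ²α≈1)
        ∷ (γ ε , γ (g ∙ g ⁻¹) , reflexive (cong γ (≡.sym (inverseʳ g)))) ∷ [])
      (byAbelian 5 (λ a x y u v → a ⊗ (x ⊗ u ⊗ (y ⊗ u) ⊘ (v ⊗ u)) ⊜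
          #1 ⊗ (y ⊘ x ⊗ (x ⊗ x ⊗ a ⊘ #1 ⊗ (u ⊘ v ⊗ #1))))
        (α g (g ⁻¹) ∷ γ g ∷ γ (g ⁻¹) ∷ γ ε ∷ γ (g ∙ g ⁻¹) ∷ []) ≡.refl)

-- The subgroup and factor set of a weight.

module Invariant (em : ExcludedMiddle 0ℓ) (F : CompleteOrderedField) (𝔾 : FiniteGroup) where
  open Weights F 𝔾
  open Complex F
  open Cohomology F
  open ComplexNumbers em F
  open Matrices em F 𝔾
  open AbelianGroupSolver unitGroup
  open FiniteGroup 𝔾 renaming (Carrier to G)
  open Group group using (_\\_; assoc; identityˡ; identityʳ)
  open GroupProperties group using (\\-leftDividesˡ; \\-leftDividesʳ)
  open SetoidReasoning setoid

  module OfWeight (W : Matrix) (isWeight : IsWeight W) where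
    open IsWeight isWeight

    spt-\\ : ∀ {x y x′ y′} → x \\ y ≡ x′ \\ y′ → spt W x y → spt W x′ y′
    spt-\\ {x} {y} {x′} {y′} eq s =
      -- Membership in a union of classes `c g` is a condition on the quotient `x⁻¹y` alone.
      let g , g∈S , x∙g≡y = proj₁ (proj₂ W1-union) s
          g≡x′\\y′ = ≡.trans (≡.sym (\\-leftDividesʳ x g)) (≡.trans (cong (x \\_) x∙g≡y) eq)
      in proj₂ (proj₂ W1-union) (g , g∈S , ≡.trans (cong (x′ ∙_) g≡x′\\y′) (\\-leftDividesˡ x′ y′))

    ω : G → G → ℂˣ
    ω x y = unit (W x y)

    -- Abstract for the same reason as twist.
    abstract
      α : G → G → ℂˣ
      α g h = ω ε g · ω g (g ∙ h) · ω ε (g ∙ h) ⁻¹ˣ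

      α-· : ∀ g h → α g h · ω ε (g ∙ h) ≈ˣ ω ε g · ω g (g ∙ h)
      α-· g h = byAbelian 2 (λ p q → p ⊘ q ⊗ q ⊜ p) (ω ε g · ω g (g ∙ h) ∷ ω ε (g ∙ h) ∷ []) ≡.refl

    abstract
      product : ∀ g h → InSpan W (A[ W ] g ⊛ A[ W ] h)
      product g h = W3 (A[ W ] g) (A[ W ] h) (A-inSpan W g) (A-inSpan W h)

    -- The coefficient of `A[ W ] (g ∙ h)` in the product. Where that matrix vanishes the
    -- coefficient is arbitrary, so `α` is read off from the entries of `W` and agrees with it only
    -- on the support.
    structureConstant : G → G → ℂ
    structureConstant g h = proj₁ (product g h) (g ∙ h)

    -- The product of two basis matrices has a single term at `(x, z)`, the one through `y`. The
    -- identity holds for all points, not only within a coset, and this is what forces the support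
    -- to be closed under products.
    W-law : ∀ x y z → W x y * W y z ≈ structureConstant (x \\ y) (y \\ z) * W x z
    W-law x y z = go (x \\ y) (y \\ z) (≡.sym (\\-leftDividesˡ x y)) (≡.sym (\\-leftDividesˡ y z))
      where
      go : ∀ g h → y ≡ x ∙ g → z ≡ y ∙ h → W x y * W y z ≈ structureConstant g h * W x z
      go g h ≡.refl ≡.refl = trans (sym (A-⊛-A W g h x z ≡.refl))
        (subst (λ k → (A[ W ] g ⊛ A[ W ] h) x z ≈ proj₁ (product g h) k * W x z)
          (≡.trans (cong (x \\_) (assoc x g h)) (\\-leftDividesʳ x (g ∙ h)))
          (inSpan-at {W} {A[ W ] g ⊛ A[ W ] h} (product g h) x z))

    ω-value : ∀ {x y} → spt W x y → value (ω x y) ≈ W x y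
    ω-value = value-unit

    ε\\g≡g : ∀ g → ε \\ g ≡ g
    ε\\g≡g g = ≡.trans (cong (ε \\_) (≡.sym (identityˡ g))) (\\-leftDividesʳ ε g)

    W-law-ε : ∀ g h → W ε g * W g (g ∙ h) ≈ structureConstant g h * W ε (g ∙ h)
    W-law-ε g h = begin
      W ε g * W g (g ∙ h)
        ≈⟨ W-law ε g (g ∙ h) ⟩
      structureConstant (ε \\ g) (g \\ (g ∙ h)) * W ε (g ∙ h)
        ≡⟨ cong₂ (λ u v → structureConstant u v * W ε (g ∙ h)) (ε\\g≡g g) (\\-leftDividesʳ g h) ⟩
      structureConstant g h * W ε (g ∙ h) ∎

    spt-∙ : ∀ {g h} → spt W ε g → spt W ε h → spt W ε (g ∙ h)
    spt-∙ {g} {h} s t Wgh≈0 = value≉0 (ω ε g · ω g (g ∙ h)) (begin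
      value (ω ε g) * value (ω g (g ∙ h))   ≈⟨ *-cong (ω-value s) (ω-value t′) ⟩
      W ε g * W g (g ∙ h)                   ≈⟨ W-law-ε g h ⟩
      structureConstant g h * W ε (g ∙ h)   ≈⟨ *-vanishʳ Wgh≈0 ⟩
      0#                                    ∎)
      where
      t′ : spt W g (g ∙ h)
      t′ = spt-\\ (≡.trans (ε\\g≡g h) (≡.sym (\\-leftDividesʳ g h))) t

    -- Given by the row of `ε`, which by left invariance of the support determines it completely.
    support : Subgroup
    support = record
      { member    = spt W ε
      ; ε-closed  = W2 ε
      ; ∙-closed  = spt-∙
      ; ⁻¹-closed = λ {g} s → spt-\\ (≡.trans (identityʳ (g ⁻¹)) (≡.sym (ε\\g≡g (g ⁻¹))))
          (W1-sym g (λ { {x} ≡.refl → spt-\\ (≡.trans (ε\\g≡g g) (≡.sym (\\-leftDividesʳ x g))) s }) (identityˡ g))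
      }

    open LeftCosets em 𝔾 support using (_~_; member)
    open MultiplicationLaw em 𝔾 support unitGroup using (Law; Cocycle; law⇒cocycle)

    ~⇒spt : ∀ {x y} → x ~ y → spt W x y
    ~⇒spt {x} {y} = spt-\\ (ε\\g≡g (x \\ y))

    spt⇒~ : ∀ {x y} → spt W x y → x ~ y
    spt⇒~ {x} {y} = spt-\\ (≡.sym (ε\\g≡g (x \\ y)))

    W-off : ∀ {x y} → ¬ (x ~ y) → W x y ≈ 0#
    W-off x≁y = decidable-stable em λ s → x≁y (spt⇒~ s)

    ω-≈ : ∀ {x y} → x ~ y → value (ω x y) ≈ W x y
    ω-≈ x~y = ω-value (~⇒spt x~y)

    structureConstant≈α : ∀ {g h} → g ∈ member → h ∈ member → structureConstant g h ≈ value (α g h)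
    structureConstant≈α {g} {h} g∈H h∈H = *-cancelʳ (ω ε (g ∙ h)) (begin
      structureConstant g h * value (ω ε (g ∙ h))     ≈⟨ *-congˡ (ω-value (spt-∙ g∈H h∈H)) ⟩
      structureConstant g h * W ε (g ∙ h)             ≈⟨ W-law-ε g h ⟨
      W ε g * W g (g ∙ h)                             ≈⟨ *-cong (ω-value g∈H) (ω-≈ g~gh) ⟨
      value (ω ε g · ω g (g ∙ h))                     ≈⟨ α-· g h ⟨
      value (α g h) * value (ω ε (g ∙ h))             ∎)
      where
      g~gh : g ~ g ∙ h
      g~gh = subst (spt W ε) (≡.sym (\\-leftDividesʳ g h)) h∈H

    law : Law ω α
    law {x} {y} {z} x~y y~z = begin
      value (ω x y) * value (ω y z)                     ≈⟨ *-cong (ω-≈ x~y) (ω-≈ y~z) ⟩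
      W x y * W y z                                     ≈⟨ W-law x y z ⟩
      structureConstant (x \\ y) (y \\ z) * W x z       ≈⟨ *-cong (structureConstant≈α x~y y~z) (sym (ω-≈ x~z)) ⟩
      value (α (x \\ y) (y \\ z)) * value (ω x z)       ∎
      where
      x~z : x ~ z
      x~z = LeftCosets.~-trans em 𝔾 support x~y y~z

    abstract
      α-cocycle : Cocycle α
      α-cocycle = law⇒cocycle {ω} {α} law

    class : ⋃H²
    class = support , record
      { α       = λ g h → α (proj₁ g) (proj₁ h)
      ; α-cong  = λ { ≡.refl ≡.refl → refl }
      ; cocycle = λ g h k → α-cocycle (proj₂ g) (proj₂ h) (proj₂ k)
      }

    isFactorSetOf : IsFactorSetOf (W , isWeight) class
    isFactorSetOf = member⇔ , λ g h → multiply (proj₂ g) (proj₂ h)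
      where
      member⇔ : ∀ g → g ∈ member ⇔ (c g ⇒ spt W)
      member⇔ g = mk⇔
        (λ g∈H → λ { {x} ≡.refl → ~⇒spt (subst member (≡.sym (\\-leftDividesʳ x g)) g∈H) })
        (λ c⇒spt → c⇒spt (identityˡ g))

      multiply : ∀ {g h} → g ∈ member → h ∈ member →
                A[ W ] g ⊛ A[ W ] h ≋ value (α g h) • A[ W ] (g ∙ h)
      multiply {g} {h} g∈H h∈H x y with y ≟ x ∙ g ∙ h
      ... | no  y≢xgh = trans (A-⊛-A-off W g h x y y≢xgh)
              (sym (*-vanishʳ (*-vanishˡ (if-false (x ∙ (g ∙ h) ≟ y) λ eq →
                y≢xgh (≡.trans (≡.sym eq) (≡.sym (assoc x g h)))))))
      ... | yes ≡.refl = begin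
        (A[ W ] g ⊛ A[ W ] h) x (x ∙ g ∙ h)                    ≈⟨ A-⊛-A W g h x (x ∙ g ∙ h) ≡.refl ⟩
        W x (x ∙ g) * W (x ∙ g) (x ∙ g ∙ h)                    ≈⟨ W-law x (x ∙ g) (x ∙ g ∙ h) ⟩
        structureConstant (x \\ (x ∙ g)) ((x ∙ g) \\ (x ∙ g ∙ h)) * W x (x ∙ g ∙ h)
          ≡⟨ cong₂ (λ u v → structureConstant u v * W x (x ∙ g ∙ h)) (\\-leftDividesʳ x g) (\\-leftDividesʳ (x ∙ g) h) ⟩
        structureConstant g h * W x (x ∙ g ∙ h)
          ≈⟨ *-cong (structureConstant≈α g∈H h∈H)
               (sym (trans (*-congʳ (if-true (x ∙ (g ∙ h) ≟ x ∙ g ∙ h) (≡.sym (assoc x g h)))) (*-identityˡ _))) ⟩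
        value (α g h) * A[ W ] (g ∙ h) x (x ∙ g ∙ h)           ∎

  classOf : Weight → ⋃H²
  classOf (W , isWeight) = OfWeight.class W isWeight

-- Equivalence of weights and equality of classes.

module Equivalences (em : ExcludedMiddle 0ℓ) (F : CompleteOrderedField) (𝔾 : FiniteGroup) where
  open Weights F 𝔾
  open Complex F
  open Cohomology F
  open ComplexNumbers em F
  open Matrices em F 𝔾
  open Invariant em F 𝔾
  open AbelianGroupSolver unitGroup hiding (⟦_⟧)
  open FiniteGroup 𝔾 renaming (Carrier to G)
  open Subgroup using (member)
  open Group group using (_\\_)
  open SetoidReasoning setoid

  ≈ᴴ²-refl : ∀ {K} → K ≈ᴴ² K
  ≈ᴴ²-refl {H , a} = ((λ p → p) , (λ p → p)) , (λ _ → 1ˣ) , (λ _ → refl) , λ g h →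
    byAbelian 1 (λ x → x ⊘ x ⊜ #1 ⊗ #1 ⊘ #1) (FactorSet.α a g h ∷ []) ≡.refl

  -- The inverse cochain. An element transported to the other subgroup and back carries a different
  -- membership proof, which is why `α-cong` and `γ-cong` appear among the relations.
  ≈ᴴ²-sym : ∀ {K L} → K ≈ᴴ² L → L ≈ᴴ² K
  ≈ᴴ²-sym {H , a} {K , b} ((H⊆K , K⊆H) , γ , γ-cong , a/b≈δγ) =
    (K⊆H , H⊆K) , (λ g → γ (ι g) ⁻¹ˣ) , (λ {g} {h} g≈h → inv-cong {γ (ι g)} {γ (ι h)} (γ-cong g≈h)) , λ g h →
      modulo ( (b.α g h , b.α (ι′ (ι g)) (ι′ (ι h)) , b.α-cong ≡.refl ≡.refl)
             ∷ (γ (ι g) · γ (ι h) · γ (ι g ∙ᴴ ι h) ⁻¹ˣ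
               , a.α (ι g) (ι h) · b.α (ι′ (ι g)) (ι′ (ι h)) ⁻¹ˣ , sym (a/b≈δγ (ι g) (ι h)))
             ∷ (γ (ι g ∙ᴴ ι h) , γ (ι (g ∙ᴷ h)) , γ-cong ≡.refl)
             ∷ [])
             {b.α g h · a.α (ι g) (ι h) ⁻¹ˣ} {γ (ι g) ⁻¹ˣ · γ (ι h) ⁻¹ˣ · (γ (ι (g ∙ᴷ h)) ⁻¹ˣ) ⁻¹ˣ}
             (byAbelian 7 (λ a b b′ x y z z′ → b ⊘ a ⊜ recip x ⊗ recip y ⊗ recip (recip z) ⊗
                 (b ⊘ b′ ⊗ (x ⊗ y ⊘ z′ ⊘ (a ⊘ b′) ⊗ (z′ ⊘ z ⊗ #1))))
               (a.α (ι g) (ι h) ∷ b.α g h ∷ b.α (ι′ (ι g)) (ι′ (ι h)) ∷ γ (ι g) ∷ γ (ι h)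
                 ∷ γ (ι (g ∙ᴷ h)) ∷ γ (ι g ∙ᴴ ι h) ∷ []) ≡.refl)
    where
    module a = FactorSet a
    module b = FactorSet b
    open Group ⟦ H ⟧ using () renaming (_∙_ to _∙ᴴ_)
    open Group ⟦ K ⟧ using () renaming (_∙_ to _∙ᴷ_)

    ι : Σ G (member K) → Σ G (member H)
    ι (g , p) = g , K⊆H p

    ι′ : Σ G (member H) → Σ G (member K)
    ι′ (g , p) = g , H⊆K p

  ≈ᴴ²-trans : ∀ {K L M} → K ≈ᴴ² L → L ≈ᴴ² M → K ≈ᴴ² M
  ≈ᴴ²-trans {H , a} {K , b} {L , c} ((H⊆K , K⊆H) , γ , γ-cong , a/b≈δγ) ((K⊆L , L⊆K) , γ′ , γ′-cong , b/c≈δγ′) =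
    ((λ p → K⊆L (H⊆K p)) , λ p → K⊆H (L⊆K p)) , (λ g → γ g · γ′ (ι g)) ,
      (λ g≈h → *-cong (γ-cong g≈h) (γ′-cong g≈h)) , λ g h →
      modulo ( (a.α g h · b.α (ι g) (ι h) ⁻¹ˣ , γ g · γ h · γ (g ∙ᴴ h) ⁻¹ˣ , a/b≈δγ g h)
             ∷ (b.α (ι g) (ι h) · c.α (ι′ (ι g)) (ι′ (ι h)) ⁻¹ˣ
               , γ′ (ι g) · γ′ (ι h) · γ′ (ι g ∙ᴷ ι h) ⁻¹ˣ , b/c≈δγ′ (ι g) (ι h))
             ∷ (γ′ (ι (g ∙ᴴ h)) , γ′ (ι g ∙ᴷ ι h) , γ′-cong ≡.refl)
             ∷ [])
             {a.α g h · c.α (ι′ (ι g)) (ι′ (ι h)) ⁻¹ˣ}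
             {γ g · γ′ (ι g) · (γ h · γ′ (ι h)) · (γ (g ∙ᴴ h) · γ′ (ι (g ∙ᴴ h))) ⁻¹ˣ}
             (byAbelian 10 (λ a b c x y z x′ y′ z′ z″ → a ⊘ c ⊜ x ⊗ x′ ⊗ (y ⊗ y′) ⊘ (z ⊗ z″) ⊗
                 (a ⊘ b ⊘ (x ⊗ y ⊘ z) ⊗ (b ⊘ c ⊘ (x′ ⊗ y′ ⊘ z′) ⊗ (z″ ⊘ z′ ⊗ #1))))
               (a.α g h ∷ b.α (ι g) (ι h) ∷ c.α (ι′ (ι g)) (ι′ (ι h)) ∷ γ g ∷ γ h ∷ γ (g ∙ᴴ h)
                 ∷ γ′ (ι g) ∷ γ′ (ι h) ∷ γ′ (ι g ∙ᴷ ι h) ∷ γ′ (ι (g ∙ᴴ h)) ∷ []) ≡.refl)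
    where
    module a = FactorSet a
    module b = FactorSet b
    module c = FactorSet c
    open Group ⟦ H ⟧ using () renaming (_∙_ to _∙ᴴ_)
    open Group ⟦ K ⟧ using () renaming (_∙_ to _∙ᴷ_)

    ι : Σ G (member H) → Σ G (member K)
    ι (g , p) = g , H⊆K p

    ι′ : Σ G (member K) → Σ G (member L)
    ι′ (g , p) = g , K⊆L p

  ≈ᴴ²-isEquivalence : IsEquivalence _≈ᴴ²_
  ≈ᴴ²-isEquivalence = record
    { refl  = λ {K} → ≈ᴴ²-refl {K}
    ; sym   = λ {K} {L} → ≈ᴴ²-sym {K} {L}
    ; trans = λ {K} {L} {M} → ≈ᴴ²-trans {K} {L} {M}
    }

  -- Outside P the choice only matters for the conditions on γ in ∼ᴴ.
  module _ (P : Pred G 0ℓ) (γ : Σ G P → ℂˣ) where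

    extend : G → ℂˣ
    extend g with em {P g}
    ... | yes p = γ (g , p)
    ... | no  _ = 1ˣ

    extend-on : (∀ {g} (p q : P g) → γ (g , p) ≈ˣ γ (g , q)) → ∀ {g} (p : P g) → γ (g , p) ≈ˣ extend g
    extend-on γ-cong {g} p with em {P g}
    ... | yes q  = γ-cong p q
    ... | no  ¬p = contradiction p ¬p

    extend-off : ∀ {g} → ¬ P g → extend g ≡ 1ˣ
    extend-off {g} ¬p with em {P g}
    ... | yes p = contradiction p ¬p
    ... | no  _ = ≡.refl

  module _ (W : Matrix) (isW : IsWeight W) (W′ : Matrix) (isW′ : IsWeight W′) where
    private
      module W  = OfWeight W isW
      module W′ = OfWeight W′ isW′
    open LeftCosets em 𝔾 W.support using (_~_)
    open MultiplicationLaw em 𝔾 W.support unitGroup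
      using (_/_≈δ_; law-transform; scaling; scaling-≈)

    classOf-cong : (W , isW) ∼ (W′ , isW′) → classOf (W , isW) ≈ᴴ² classOf (W′ , isW′)
    -- The transformation expresses `W′` by `W` and so yields `α′ / α`, the quotient in the reverse
    -- order.
    classOf-cong (a , γ , s , W′≋) = ≈ᴴ²-sym {classOf (W′ , isW′)} {classOf (W , isW)}
      ( (H′⊆H , H⊆H′) , γ ∘ proj₁ , (λ { ≡.refl → refl })
      , λ g h → law-transform {W.ω} {W.α} {W′.ω} {W′.α} a γ t (from-\\ s) W.law
          (λ p q → W′.law (H⊆H′ p) (H⊆H′ q)) ω′≈ (H′⊆H (proj₂ g)) (H′⊆H (proj₂ h)))
      where
      t : G → G
      t = Inverse.from (Aut.σ s)

      entry : ∀ x y → W′ x y ≈ inv (a x) * (value (γ (x \\ y)) * W (t x) (t y)) * value (a y)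
      entry x y = trans (W′≋ x y) (transform-at s a γ W x y)

      H′⊆H : member W′.support ⊆ member W.support
      H′⊆H {g} g∈H′ = W.spt-\\ (from-\\ s ε g) λ W≈0 →
        g∈H′ (trans (entry ε g) (*-vanishˡ (*-vanishʳ (*-vanishʳ W≈0))))

      entryˣ : ∀ {x y} → x ~ y → W′ x y ≈ value (a x ⁻¹ˣ · (γ (x \\ y) · W.ω (t x) (t y)) · a y)
      entryˣ {x} {y} x~y = trans (entry x y)
        (*-congʳ (*-congˡ (*-congˡ (sym (W.ω-value (W.spt-\\ (≡.sym (from-\\ s x y)) (W.~⇒spt x~y)))))))

      ~⇒~′ : ∀ {x y} → x ~ y → spt W′ x y
      ~⇒~′ {x} {y} x~y W′≈0 = value≉0 (a x ⁻¹ˣ · (γ (x \\ y) · W.ω (t x) (t y)) · a y)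
        (trans (sym (entryˣ x~y)) W′≈0)

      H⊆H′ : member W.support ⊆ member W′.support
      H⊆H′ {g} g∈H = ~⇒~′ (subst (spt W ε) (≡.sym (W.ε\\g≡g g)) g∈H)

      ω′≈ : ∀ {x y} → x ~ y → W′.ω x y ≈ˣ a x ⁻¹ˣ · (γ (x \\ y) · W.ω (t x) (t y)) · a y
      ω′≈ x~y = trans (W′.ω-value (~⇒~′ x~y)) (entryˣ x~y)

    module _ (H⊆H′ : member W.support ⊆ member W′.support)
             (H′⊆H : member W′.support ⊆ member W.support)
             (γ : G → ℂˣ) (α′/α≈δγ : W′.α / W.α ≈δ γ) where

      private
        law′ : ∀ {x y z} → x ~ y → y ~ z →
               W′.ω x y · W′.ω y z ≈ˣ W′.α (x \\ y) (y \\ z) · W′.ω x z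
        law′ p q = W′.law (H⊆H′ p) (H⊆H′ q)

      rescale : G → ℂˣ
      rescale = scaling {W.ω} {W.α} {W′.ω} {W′.α} γ W.law law′ α′/α≈δγ

      -- Since translations do not affect the class, the identity automorphism suffices. Off the
      -- cosets both sides vanish because the supports agree.
      W′≋transform : W′ ≋ transform rescale γ idAut W
      W′≋transform x y = trans entry (sym (transform-at idAut rescale γ W x y))
        where
        entry : W′ x y ≈ inv (rescale x) * (value (γ (x \\ y)) * W x y) * value (rescale y)
        entry with em {x ~ y}
        ... | no  x≁y = trans (W′.W-off (x≁y ∘ H′⊆H)) (sym (*-vanishˡ (*-vanishʳ (*-vanishʳ (W.W-off x≁y)))))
        ... | yes x~y = begin
          W′ x y            ≈⟨ W′.ω-≈ (H⊆H′ x~y) ⟨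
          value (W′.ω x y)  ≈⟨ scaling-≈ {W.ω} {W.α} {W′.ω} {W′.α} γ W.law law′ α′/α≈δγ x~y ⟩
          value (rescale x ⁻¹ˣ · (γ (x \\ y) · W.ω x y) · rescale y)
                            ≈⟨ *-congʳ (*-congˡ (*-congˡ (W.ω-≈ x~y))) ⟩
          inv (rescale x) * (value (γ (x \\ y)) * W x y) * value (rescale y) ∎

    module Rescaling (W′≈W : classOf (W′ , isW′) ≈ᴴ² classOf (W , isW)) where
      H⊆H′ : member W.support ⊆ member W′.support
      H⊆H′ = proj₂ (proj₁ W′≈W)

      H′⊆H : member W′.support ⊆ member W.support
      H′⊆H = proj₁ (proj₁ W′≈W)

      γ′ : Σ G (member W′.support) → ℂˣ
      γ′ = proj₁ (proj₂ W′≈W)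

      γ′-cong : ∀ {g} (p q : g ∈ member W′.support) → γ′ (g , p) ≈ˣ γ′ (g , q)
      γ′-cong p q = proj₁ (proj₂ (proj₂ W′≈W)) ≡.refl

      γ : G → ℂˣ
      γ = extend (member W′.support) γ′

      γ-on : ∀ {g} (p : g ∈ member W′.support) → γ′ (g , p) ≈ˣ γ g
      γ-on = extend-on (member W′.support) γ′ γ′-cong

      α′/α≈δγ : W′.α / W.α ≈δ γ
      α′/α≈δγ {g} {h} g∈H h∈H = trans (proj₂ (proj₂ (proj₂ W′≈W)) (g , p) (h , q))
        (*-cong (*-cong (γ-on p) (γ-on q)) (inv-cong {γ′ (g ∙ h , W′.spt-∙ p q)} {γ (g ∙ h)} (γ-on (W′.spt-∙ p q))))
        where
        p = H⊆H′ g∈H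
        q = H⊆H′ h∈H

      a : G → ℂˣ
      a = rescale H⊆H′ H′⊆H γ α′/α≈δγ

      W′≋ : W′ ≋ transform a γ idAut W
      W′≋ = W′≋transform H⊆H′ H′⊆H γ α′/α≈δγ

-- Unimodularity of the data relating two H-weights.

module HEquivalences (em : ExcludedMiddle 0ℓ) (F : CompleteOrderedField) (𝔾 : FiniteGroup) where
  open Weights F 𝔾
  open Complex F
  open ComplexNumbers em F
  open Invariant em F 𝔾
  open Equivalences em F 𝔾
  open FiniteGroup 𝔾 renaming (Carrier to G)
  open Subgroup using (member)
  open Group group using (_\\_; inverseʳ; identityˡ; identityʳ)
  open GroupProperties group using (⁻¹-involutive)
  open SetoidReasoning setoid
  private
    module UP = AbelianGroupProperties unitGroup
    module |U| = AbelianGroup modulusGroup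
    module |UP| = AbelianGroupProperties modulusGroup

  module OfHWeight (W : Matrix) (isH : IsHWeight W) where
    open IsHWeight isH
    open OfWeight W isWeight public
    open IsWeight isWeight using (W2)

    ∣ω∣≈1 : ∀ x y → ∣ ω x y ∣≈1
    ∣ω∣≈1 x y = ∣unit∣≈1 λ s → N≈1 s (modulus x y)
      where
      N≈1 : spt W x y → (∣ W x y ∣≈ R.0#) ⊎ (∣ W x y ∣≈ R.1#) → N (W x y) R.≈ R.1#
      N≈1 s (inj₁ (_ , 0≈N)) = contradiction (N≈0⇒≈0 (R.trans (R.sym 0≈N) (R.zeroˡ R.0#))) s
      N≈1 s (inj₂ (_ , 1≈N)) = R.trans (R.sym 1≈N) (R.*-identityˡ R.1#)

    ∣α∣≈1 : ∀ g h → ∣ α g h ∣≈1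
    ∣α∣≈1 g h = R.trans (R.sym (R.*-identityʳ _)) (R.trans (R.*-congˡ (R.sym (∣ω∣≈1 ε (g ∙ h))))
      (R.trans (R.sym (N-* (value (α g h)) (value (ω ε (g ∙ h))))) (R.trans (N-cong (α-· g h))
        (∣∣≈1-· (ω ε g) (ω g (g ∙ h)) (∣ω∣≈1 ε g) (∣ω∣≈1 g (g ∙ h))))))

    ω-unital : ω ε ε ≈ˣ 1ˣ
    ω-unital = trans (ω-value (W2 ε)) (unital ε)

    α-ε : α ε ε ≈ˣ 1ˣ
    α-ε = trans (*-cancelʳ (ω ε (ε ∙ ε)) (α-· ε ε)) ω-unital

    -- Hermiticity makes the entry at `(g, ε)` the conjugate of the one at `(ε, g)`, which for
    -- modulus 1 is its inverse.
    α-⁻¹ : ∀ {g} → g ∈ member support → α g (g ⁻¹) ≈ˣ 1ˣ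
    α-⁻¹ {g} g∈H = *-cancelʳ (ω ε (g ∙ g ⁻¹)) (begin
      value (α g (g ⁻¹)) * value (ω ε (g ∙ g ⁻¹))   ≈⟨ α-· g (g ⁻¹) ⟩
      value (ω ε g) * value (ω g (g ∙ g ⁻¹))        ≡⟨ cong (λ u → value (ω ε g) * value (ω g u)) (inverseʳ g) ⟩
      value (ω ε g) * value (ω g ε)                 ≈⟨ *-congˡ (trans (ω-value g~ε)
                                                        (trans (hermitian ε g) (conj-cong (sym (ω-value g∈H))))) ⟩
      value (ω ε g) * conj (value (ω ε g))          ≈⟨ z*z̄≈N (value (ω ε g)) ⟩
      fromℝ (N (value (ω ε g)))                     ≈⟨ fromℝ-cong (∣ω∣≈1 ε g) ⟩
      1#                                            ≈⟨ ω-unital ⟨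
      value (ω ε ε)                                 ≡⟨ cong (λ u → value (ω ε u)) (inverseʳ g) ⟨
      value (ω ε (g ∙ g ⁻¹))                        ≈⟨ *-identityˡ _ ⟨
      1# * value (ω ε (g ∙ g ⁻¹))                   ∎)
      where
      g~ε : spt W g ε
      g~ε = spt-\\ (≡.trans (ε\\g≡g (g ⁻¹)) (≡.sym (identityʳ (g ⁻¹)))) (Subgroup.⁻¹-closed support g∈H)

  module HRescaling (W : Matrix) (isH : IsHWeight W) (W′ : Matrix) (isH′ : IsHWeight W′)
                    (W′≈W : classOf (toWeight (W′ , isH′)) ≈ᴴ² classOf (toWeight (W , isH))) where
    private
      module W  = OfHWeight W isH
      module W′ = OfHWeight W′ isH′
    open Rescaling W (IsHWeight.isWeight isH) W′ (IsHWeight.isWeight isH′) W′≈W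
    open UniquelyDivisible em 𝔾 W.support modulusGroup modulus-divisible modulus-torsionFree

    -- |γ| is a homomorphism from a finite group to the positive reals, hence trivial.
    γ-hom : ∀ {g h} → g ∈ member W.support → h ∈ member W.support → γ (g ∙ h) |U|.≈ γ g · γ h
    γ-hom {g} {h} g∈H h∈H = R.sym (|UP|.x∙y⁻¹≈ε⇒x≈y (γ g · γ h) (γ (g ∙ h)) (R.trans
      (R.sym (N-cong (α′/α≈δγ g∈H h∈H)))
      (R.trans (∣∣≈1-· (W′.α g h) (W.α g h ⁻¹ˣ) (W′.∣α∣≈1 g h) (∣∣≈1-⁻¹ (W.α g h) (W.∣α∣≈1 g h))) (R.sym N1≈1))))

    γ-off : ∀ {g} → g ∉ member W.support → γ g ≡ 1ˣ
    γ-off g∉H = extend-off (member W′.support) γ′ (g∉H ∘ H′⊆H)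

    ∣γ∣≈1 : ∀ g → ∣ γ g ∣≈1
    ∣γ∣≈1 g = go em
      where
      go : Dec (g ∈ member W.support) → ∣ γ g ∣≈1
      go (yes g∈H) = R.trans (H¹-trivial γ γ-hom g∈H) N1≈1
      go (no  g∉H) = subst ∣_∣≈1 (≡.sym (γ-off g∉H)) N1≈1

    ∣a∣≈1 : ∀ x → ∣ a x ∣≈1
    ∣a∣≈1 x = ∣∣≈1-· (W′.ω p x) ((γ (p \\ x) · W.ω p x) ⁻¹ˣ) (W′.∣ω∣≈1 p x)
      (∣∣≈1-⁻¹ (γ (p \\ x) · W.ω p x) (∣∣≈1-· (γ (p \\ x)) (W.ω p x) (∣γ∣≈1 (p \\ x)) (W.∣ω∣≈1 p x)))
      where
      p = LeftCosets.representative em 𝔾 W.support x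

    -- The coboundary of `γ` at `(ε, ε)` is `γ ε` itself, and both factor sets are 1 there.
    γ-ε : γ ε ≈ˣ 1ˣ
    γ-ε = trans (sym (byγ (γ ε) (γ (ε ∙ ε)) (cong γ (identityˡ ε))))
      (trans (sym (α′/α≈δγ ε∈H ε∈H)) (ratio≈1 {W′.α ε ε} {W.α ε ε} W′.α-ε W.α-ε))
      where
      ε∈H = Subgroup.ε-closed W.support
      byγ : ∀ u v → v ≡ u → u · u · v ⁻¹ˣ ≈ˣ u
      byγ u _ ≡.refl = trans (*-assoc (value u) (value u) (inv u))
        (trans (*-congˡ (ℂˣ.inverseʳ u)) (*-identityʳ (value u)))

    γ-⁻¹ : ∀ g → γ (g ⁻¹) ≈ˣ γ g ⁻¹ˣ
    γ-⁻¹ g = go em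
      where
      go : Dec (g ∈ member W.support) → γ (g ⁻¹) ≈ˣ γ g ⁻¹ˣ
      go (yes g∈H) = UP.inverseʳ-unique (γ g) (γ (g ⁻¹)) (UP.x∙y⁻¹≈ε⇒x≈y (γ g · γ (g ⁻¹)) 1ˣ
        (trans (*-congˡ (inv-cong {1ˣ} {γ (g ∙ g ⁻¹)} (sym γgg⁻¹≈1)))
          (trans (sym (α′/α≈δγ g∈H (Subgroup.⁻¹-closed W.support g∈H)))
            (ratio≈1 {W′.α g (g ⁻¹)} {W.α g (g ⁻¹)} (W′.α-⁻¹ (H⊆H′ g∈H)) (W.α-⁻¹ g∈H)))))
        where
        γgg⁻¹≈1 : γ (g ∙ g ⁻¹) ≈ˣ 1ˣ
        γgg⁻¹≈1 = subst (λ h → γ h ≈ˣ 1ˣ) (≡.sym (inverseʳ g)) γ-ε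
      go (no g∉H) = trans (reflexive (cong value (γ-off g⁻¹∉H)))
        (sym (inv-cong {γ g} {1ˣ} (reflexive (cong value (γ-off g∉H)))))
        where
        g⁻¹∉H : g ⁻¹ ∉ member W.support
        g⁻¹∉H p = g∉H (subst (_∈ member W.support) (⁻¹-involutive g) (Subgroup.⁻¹-closed W.support p))

-- Unimodular normalised factor sets in every class.

module Normalisation (em : ExcludedMiddle 0ℓ) (F : CompleteOrderedField) (𝔾 : FiniteGroup)
                     (H : FiniteGroup.Subgroup 𝔾) where
  open Complex F using (ℂˣ)
  open ComplexNumbers em F
  open UnitCircle em F
  open FiniteGroup 𝔾 renaming (Carrier to G)
  open LeftCosets em 𝔾 H using (member; ε-closed; ∙-closed; ⁻¹-closed; ⁻¹-involutive)
  open MultiplicationLaw em 𝔾 H unitGroup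
  private
    module |M| = MultiplicationLaw em 𝔾 H modulusGroup
  open UniquelyDivisible em 𝔾 H modulusGroup modulus-divisible modulus-torsionFree using (H²-trivial)

  module _ {α : G → G → ℂˣ} (cocycle : Cocycle α) where

    -- The moduli of `α` form a cocycle with values in a uniquely divisible group, hence a
    -- coboundary; dividing `α` by the coboundary of the same cochain, now taken in the units,
    -- leaves modulus 1.
    unimodularise : Σ[ γ ∈ (G → ℂˣ) ] (∀ {g h} → g ∈ member → h ∈ member → ∣ twist 𝔾 _·_ _⁻¹ˣ α γ g h ∣≈1)
    unimodularise =
      let γ , p = H²-trivial α λ g∈H h∈H k∈H → N-cong (cocycle g∈H h∈H k∈H)
      in (λ g → γ g ⁻¹ˣ) , λ {g} {h} g∈H h∈H → R.trans (|M|.twist-trivial {α} {γ} g h (p g∈H h∈H)) N1≈1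

    module _ (∣α∣≈1 : ∀ {g h} → g ∈ member → h ∈ member → ∣ α g h ∣≈1) where

      inverseRoot : G → ℂˣ
      inverseRoot g = √ (α g (g ⁻¹)) ⁻¹ˣ

      ∣inverseRoot∣≈1 : ∀ {g} → g ∈ member → ∣ inverseRoot g ∣≈1
      ∣inverseRoot∣≈1 {g} g∈H = ∣∣≈1-⁻¹ (√ (α g (g ⁻¹))) (∣√∣≈1 (α g (g ⁻¹)) (∣α∣≈1 g∈H (⁻¹-closed g∈H)))

      inverseRoot-⁻¹ : ∀ {g} → g ∈ member → inverseRoot (g ⁻¹) ≈ˣ inverseRoot g
      inverseRoot-⁻¹ {g} g∈H = inv-cong {√ (α (g ⁻¹) (g ⁻¹ ⁻¹))} {√ (α g (g ⁻¹))}
        (√-cong {α (g ⁻¹) (g ⁻¹ ⁻¹)} {α g (g ⁻¹)}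
          (subst (λ h → α (g ⁻¹) h ≈ˣ α g (g ⁻¹)) (≡.sym (⁻¹-involutive g)) (cocycle-⁻¹ {α} cocycle g∈H)))

      inverseRoot-square : ∀ {g} → g ∈ member → inverseRoot g · inverseRoot g · α g (g ⁻¹) ≈ˣ 1ˣ
      inverseRoot-square {g} g∈H = cancel (√ (α g (g ⁻¹))) (α g (g ⁻¹))
        (√-square (α g (g ⁻¹)) (∣α∣≈1 g∈H (⁻¹-closed g∈H)))
        where
        cancel : ∀ u v → u · u ≈ˣ v → u ⁻¹ˣ · u ⁻¹ˣ · v ≈ˣ 1ˣ
        cancel u v u²≈v = modulo ((v , u · u , sym u²≈v) ∷ []) {u ⁻¹ˣ · u ⁻¹ˣ · v} {1ˣ}
          (byAbelian 2 (λ u v → recip u ⊗ recip u ⊗ v ⊜ #1 ⊗ (v ⊘ (u ⊗ u) ⊗ #1)) (u ∷ v ∷ []) ≡.refl)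
          where open AbelianGroupSolver unitGroup

  module _ {α : G → G → ℂˣ} (∣α∣≈1 : ∀ {g h} → g ∈ member → h ∈ member → ∣ α g h ∣≈1)
           {r : G → ℂˣ} (∣r∣≈1 : ∀ {g} → g ∈ member → ∣ r g ∣≈1) where

    normaliser : G → ℂˣ
    normaliser g = r g · r ε

    ∣normaliser∣≈1 : ∀ {g} → g ∈ member → ∣ normaliser g ∣≈1
    ∣normaliser∣≈1 {g} g∈H = ∣∣≈1-· (r g) (r ε) (∣r∣≈1 g∈H) (∣r∣≈1 ε-closed)

    opaque
      unfolding twist

      ∣normalised∣≈1 : ∀ {g h} → g ∈ member → h ∈ member → ∣ twist 𝔾 _·_ _⁻¹ˣ α normaliser g h ∣≈1
      ∣normalised∣≈1 {g} {h} g∈H h∈H = ∣∣≈1-· (α g h) (normaliser g · normaliser h · normaliser (g ∙ h) ⁻¹ˣ)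
        (∣α∣≈1 g∈H h∈H)
        (∣∣≈1-· (normaliser g · normaliser h) (normaliser (g ∙ h) ⁻¹ˣ)
          (∣∣≈1-· (normaliser g) (normaliser h) (∣normaliser∣≈1 g∈H) (∣normaliser∣≈1 h∈H))
          (∣∣≈1-⁻¹ (normaliser (g ∙ h)) (∣normaliser∣≈1 (∙-closed g∈H h∈H))))

  record NormalForm (α : G → G → ℂˣ) : Set where
    field
      β         : G → G → ℂˣ
      γ         : G → ℂˣ
      β-cocycle : Cocycle β
      β/α≈δγ    : β / α ≈δ γ
      ∣β∣≈1     : ∀ {g h} → g ∈ member → h ∈ member → ∣ β g h ∣≈1
      β-⁻¹      : ∀ {g} → g ∈ member → β g (g ⁻¹) ≈ˣ 1ˣ

  module _ {α : G → G → ℂˣ} where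

    normaliseUnimodular : ∀ γ₁ → let α₁ = twist 𝔾 _·_ _⁻¹ˣ α γ₁ in
      Cocycle α₁ → (∀ {g h} → g ∈ member → h ∈ member → ∣ α₁ g h ∣≈1) →
      (r : G → ℂˣ) → (∀ {g} → g ∈ member → ∣ r g ∣≈1) → (∀ {g} → g ∈ member → r (g ⁻¹) ≈ˣ r g) →
      (∀ {g} → g ∈ member → r g · r g · α₁ g (g ⁻¹) ≈ˣ 1ˣ) → NormalForm α
    normaliseUnimodular γ₁ cocycle₁ ∣α₁∣≈1 r ∣r∣≈1 r-⁻¹ r²α≈1 = record
      { β         = twist 𝔾 _·_ _⁻¹ˣ (twist 𝔾 _·_ _⁻¹ˣ α γ₁) (λ g → r g · r ε)
      ; γ         = λ g → γ₁ g · (r g · r ε)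
      ; β-cocycle = twist-cocycle {twist 𝔾 _·_ _⁻¹ˣ α γ₁} (λ g → r g · r ε) cocycle₁
      ; β/α≈δγ    = λ {g} {h} _ _ → twist-twist {α} γ₁ (λ g → r g · r ε) g h
      ; ∣β∣≈1     = ∣normalised∣≈1 {twist 𝔾 _·_ _⁻¹ˣ α γ₁} ∣α₁∣≈1 {r} ∣r∣≈1
      ; β-⁻¹      = λ {g} g∈H → twist-normal {twist 𝔾 _·_ _⁻¹ˣ α γ₁} {r} g (r-⁻¹ g∈H) (r²α≈1 g∈H)
      }

    abstract
      normalForm : Cocycle α → NormalForm α
      normalForm cocycle =
        let γ₁ , ∣α₁∣≈1 = unimodularise {α} cocycle
            cocycle₁    = twist-cocycle {α} γ₁ cocycle
            α₁          = twist 𝔾 _·_ _⁻¹ˣ α γ₁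
        in normaliseUnimodular γ₁ cocycle₁ ∣α₁∣≈1 (inverseRoot {α₁} cocycle₁ ∣α₁∣≈1)
             (∣inverseRoot∣≈1 {α₁} cocycle₁ ∣α₁∣≈1) (inverseRoot-⁻¹ {α₁} cocycle₁ ∣α₁∣≈1)
             (inverseRoot-square {α₁} cocycle₁ ∣α₁∣≈1)

-- A weight with a prescribed factor set.

module Construction (em : ExcludedMiddle 0ℓ) (F : CompleteOrderedField) (𝔾 : FiniteGroup)
                    (H : FiniteGroup.Subgroup 𝔾) where
  open Weights F 𝔾
  open Complex F
  open Cohomology F
  open ComplexNumbers em F
  open Matrices em F 𝔾
  open Invariant em F 𝔾
  open FiniteGroup 𝔾 renaming (Carrier to G)
  open LeftCosets em 𝔾 H
  open MultiplicationLaw em 𝔾 H unitGroup using (Cocycle; cocycle-onPoints; cocycle-εʳ)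
  open GroupSum +-commutativeMonoid 𝔾 using (∑-cong; ∑-translate)
  open SemiringSum (CommutativeRing.semiring commutativeRing) using (*-distribʳ-sum)
  open CommutativeSemigroupProperties (CommutativeRing.*-commutativeSemigroup commutativeRing) using (interchange)
  open SetoidReasoning setoid

  module _ (β : G → G → ℂˣ) (cocycle : Cocycle β) where

    ω : G → G → ℂˣ
    ω x y = β (representative x \\ x) (x \\ y)

    W : Matrix
    W x y = if does (em {x ~ y}) then value (ω x y) else 0#

    W-on : ∀ {x y} → x ~ y → W x y ≈ value (ω x y)
    W-on = if-true em

    W-off : ∀ {x y} → ¬ (x ~ y) → W x y ≈ 0#
    W-off = if-false em

    ~⇒spt : ∀ {x y} → x ~ y → spt W x y
    ~⇒spt {x} {y} x~y W≈0 = value≉0 (ω x y) (trans (sym (W-on x~y)) W≈0)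

    spt⇒~ : ∀ {x y} → spt W x y → x ~ y
    spt⇒~ s = decidable-stable em λ x≁y → s (W-off x≁y)

    -- The cocycle identity along `p`, `x`, `y`, `z`, where `p` is the common representative.
    ω-law : ∀ {x y z} → x ~ y → y ~ z → ω x y · ω y z ≈ˣ β (x \\ y) (y \\ z) · ω x z
    ω-law {x} {y} {z} x~y y~z = subst
      (λ p → ω x y · β (p \\ y) (y \\ z) ≈ˣ β (x \\ y) (y \\ z) · ω x z) (representative-cong x~y)
      (trans (cocycle-onPoints {β} cocycle (representative-~ x) x~y y~z) (*-comm _ _))

    W-law : ∀ {x y z} → x ~ y → y ~ z → W x y * W y z ≈ value (β (x \\ y) (y \\ z)) * W x z
    W-law {x} {y} {z} x~y y~z = trans (*-cong (W-on x~y) (W-on y~z))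
      (trans (ω-law x~y y~z) (*-congˡ (sym (W-on (~-trans x~y y~z)))))

    -- The structure constants, as a function of g and of the product u.
    b : G → G → ℂ
    b g u = if does (em {g ∈ member}) then value (β g (g \\ u)) else 0#

    -- Valid for all `x` and `y`, also across cosets, with a coefficient depending only on `g` and
    -- `x⁻¹y`: membership in the span demands exactly this uniformity.
    entries : ∀ g x y → W x (x ∙ g) * W (x ∙ g) y ≈ b g (x \\ y) * W x y
    entries g x y = go em em
      where
      u = x \\ y

      g\\u : (x ∙ g) \\ y ≡ g \\ u
      g\\u = ≡.trans (cong (_∙ y) (⁻¹-anti-homo-∙ x g)) (assoc (g ⁻¹) (x ⁻¹) y)

      go : Dec (g ∈ member) → Dec (x ~ y) → W x (x ∙ g) * W (x ∙ g) y ≈ b g u * W x y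
      go (no g∉H) _ = trans
        (*-vanishˡ (W-off λ x~xg → g∉H (subst member (\\-leftDividesʳ x g) x~xg)))
        (sym (*-vanishˡ (if-false em g∉H)))
      go (yes g∈H) (no x≁y) = trans
        (*-vanishʳ (W-off λ xg~y → x≁y (~-trans (~-∙ x g∈H) xg~y)))
        (sym (*-vanishʳ (W-off x≁y)))
      go (yes g∈H) (yes x~y) = begin
        W x (x ∙ g) * W (x ∙ g) y
          ≈⟨ W-law (~-∙ x g∈H) (~-trans (~-sym (~-∙ x g∈H)) x~y) ⟩
        value (β (x \\ (x ∙ g)) ((x ∙ g) \\ y)) * W x y
          ≡⟨ cong₂ (λ h k → value (β h k) * W x y) (\\-leftDividesʳ x g) g\\u ⟩
        value (β g (g \\ u)) * W x y
          ≈⟨ *-congʳ (if-true em g∈H) ⟨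
        b g u * W x y ∎

    module _ {M N : Matrix} (M∈span : InSpan W M) (N∈span : InSpan W N) where
      private
        k = proj₁ M∈span
        l = proj₁ N∈span

      term : G → G → ℂ
      term u g = k g * l (g \\ u) * b g u

      term-at : ∀ x y g → M x (x ∙ g) * N (x ∙ g) y ≈ term (x \\ y) g * W x y
      term-at x y g = begin
        M x (x ∙ g) * N (x ∙ g) y
          ≈⟨ *-cong (inSpan-at {W} {M} M∈span x (x ∙ g)) (inSpan-at {W} {N} N∈span (x ∙ g) y) ⟩
        k (x \\ (x ∙ g)) * W x (x ∙ g) * (l ((x ∙ g) \\ y) * W (x ∙ g) y)
          ≡⟨ cong₂ (λ h h′ → k h * W x (x ∙ g) * (l h′ * W (x ∙ g) y)) (\\-leftDividesʳ x g)
               (≡.trans (cong (_∙ y) (⁻¹-anti-homo-∙ x g)) (assoc (g ⁻¹) (x ⁻¹) y)) ⟩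
        k g * W x (x ∙ g) * (l (g \\ (x \\ y)) * W (x ∙ g) y)
          ≈⟨ interchange (k g) (W x (x ∙ g)) (l (g \\ (x \\ y))) (W (x ∙ g) y) ⟩
        k g * l (g \\ (x \\ y)) * (W x (x ∙ g) * W (x ∙ g) y)
          ≈⟨ *-congˡ (entries g x y) ⟩
        k g * l (g \\ (x \\ y)) * (b g (x \\ y) * W x y)
          ≈⟨ *-assoc (k g * l (g \\ (x \\ y))) (b g (x \\ y)) (W x y) ⟨
        term (x \\ y) g * W x y ∎

      ⊛-inSpan : InSpan W (M ⊛ N)
      ⊛-inSpan = (λ u → ∑ (term u)) , λ x y → begin
        -- With `z = x g`, each summand depends on `(x, y)` only through `x⁻¹y`, apart from the
        -- factor `W x y`.
        (M ⊛ N) x y                               ≈⟨ ∑-translate x (λ z → M x z * N z y) ⟩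
        ∑ (λ g → M x (x ∙ g) * N (x ∙ g) y)       ≈⟨ ∑-cong {λ g → M x (x ∙ g) * N (x ∙ g) y} (term-at x y) ⟩
        ∑ (λ g → term (x \\ y) g * W x y)         ≈⟨ *-distribʳ-sum (W x y) (term (x \\ y) ∘ Inverse.to enumeration) ⟨
        ∑ (term (x \\ y)) * W x y                 ≈⟨ linComb-at (λ u → ∑ (term u)) W x y ⟨
        linComb (λ u → ∑ (term u)) A[ W ] x y     ∎

    abstract
      isWeight : IsWeight W
      isWeight = record
        { W1-union = member
                   , (λ {x} {y} s → x \\ y , spt⇒~ s , \\-leftDividesˡ x y)
                   , (λ { {x} (g , g∈H , ≡.refl) → ~⇒spt (~-∙ x g∈H) })
        ; W1-sym   = λ g c⇒spt y∙g≡x → ~⇒spt (~-sym (spt⇒~ (c⇒spt y∙g≡x)))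
        ; W2       = λ x → ~⇒spt (~-refl x)
        ; W3       = λ M N → ⊛-inSpan {M} {N}
        }

    private module W = OfWeight W isWeight

    support⊆H : W.support .Subgroup.member ⊆ member
    support⊆H {g} s = subst member (W.ε\\g≡g g) (spt⇒~ s)

    H⊆support : member ⊆ W.support .Subgroup.member
    H⊆support {g} g∈H = ~⇒spt (subst member (≡.sym (W.ε\\g≡g g)) g∈H)

    α≈β : ∀ {g h} → g ∈ member → h ∈ member → W.α g h ≈ˣ β g h
    α≈β {g} {h} g∈H h∈H = *-cancelʳ (W.ω ε (g ∙ h)) (begin
      value (W.α g h) * value (W.ω ε (g ∙ h))        ≈⟨ W.α-· g h ⟩
      value (W.ω ε g) * value (W.ω g (g ∙ h))        ≈⟨ *-cong (W.ω-value (H⊆support g∈H)) (W.ω-value (~⇒spt g~gh)) ⟩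
      W ε g * W g (g ∙ h)                            ≈⟨ W-law ε~g g~gh ⟩
      value (β (ε \\ g) (g \\ (g ∙ h))) * W ε (g ∙ h)
        ≡⟨ cong₂ (λ u v → value (β u v) * W ε (g ∙ h)) (W.ε\\g≡g g) (\\-leftDividesʳ g h) ⟩
      value (β g h) * W ε (g ∙ h)                    ≈⟨ *-congˡ (W.ω-value (H⊆support (∙-closed g∈H h∈H))) ⟨
      value (β g h) * value (W.ω ε (g ∙ h))          ∎)
      where
      ε~g : ε ~ g
      ε~g = subst member (≡.sym (W.ε\\g≡g g)) g∈H

      g~gh : g ~ g ∙ h
      g~gh = ~-∙ g h∈H

    classOf-≈ : (a : FactorSet ⟦ H ⟧) (γ : G → ℂˣ) →
                (∀ g h → β (proj₁ g) (proj₁ h) · FactorSet.α a g h ⁻¹ˣ ≈ˣ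
                         γ (proj₁ g) · γ (proj₁ h) · γ (proj₁ g ∙ proj₁ h) ⁻¹ˣ) →
                classOf (W , isWeight) ≈ᴴ² (H , a)
    classOf-≈ a γ β/a≈δγ = (support⊆H , H⊆support) , γ ∘ proj₁ , (λ { ≡.refl → refl }) ,
      λ (g , p) (h , q) → trans (*-congʳ (α≈β (support⊆H p) (support⊆H q)))
        (β/a≈δγ (g , support⊆H p) (h , support⊆H q))

    module _ (∣β∣≈1 : ∀ {g h} → g ∈ member → h ∈ member → ∣ β g h ∣≈1)
             (β-⁻¹ : ∀ {g} → g ∈ member → β g (g ⁻¹) ≈ˣ 1ˣ) where

      N-on : ∀ {x y} → x ~ y → N (W x y) R.≈ R.1#
      N-on {x} x~y = R.trans (N-cong (W-on x~y)) (∣β∣≈1 (representative-~ x) x~y)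

      -- A diagonal entry is a value `β h ε`, which equals `β ε ε` for every cocycle; the latter is
      -- 1 by `β-⁻¹` at `ε`.
      W-unital : ∀ x → W x x ≈ 1#
      W-unital x = begin
        W x x                                    ≈⟨ W-on (~-refl x) ⟩
        value (β (representative x \\ x) (x \\ x))
          ≡⟨ cong (λ u → value (β (representative x \\ x) u)) (inverseˡ x) ⟩
        value (β (representative x \\ x) ε)      ≈⟨ cocycle-εʳ {β} cocycle (representative-~ x) ⟩
        value (β ε ε)                            ≡⟨ cong (λ u → value (β ε u)) ε⁻¹≡ε ⟨
        value (β ε (ε ⁻¹))                       ≈⟨ β-⁻¹ ε-closed ⟩
        1#                                       ∎
        where
        ε⁻¹≡ε : ε ⁻¹ ≡ ε
        ε⁻¹≡ε = ≡.trans (≡.sym (identityʳ (ε ⁻¹))) (inverseˡ ε)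

      W-inverse : ∀ {x y} → x ~ y → W x y * W y x ≈ 1#
      W-inverse {x} {y} x~y = begin
        W x y * W y x                              ≈⟨ W-law x~y (~-sym x~y) ⟩
        value (β (x \\ y) (y \\ x)) * W x x        ≈⟨ *-cong βxy≈1 (W-unital x) ⟩
        1# * 1#                                    ≈⟨ *-identityˡ 1# ⟩
        1#                                         ∎
        where
        βxy≈1 : value (β (x \\ y) (y \\ x)) ≈ 1#
        βxy≈1 = subst (λ u → value (β (x \\ y) u) ≈ 1#) (⁻¹-anti-homo-\\ x y) (β-⁻¹ x~y)

      W-conj : ∀ {x y} → x ~ y → W x y * conj (W x y) ≈ 1#
      W-conj x~y = trans (z*z̄≈N _) (fromℝ-cong (N-on x~y))

      -- On the support, `W y x` and the conjugate of `W x y` are both inverse to `W x y`, the first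
      -- by `β-⁻¹` and the second by modulus 1.
      W-hermitian : ∀ x y → W y x ≈ conj (W x y)
      W-hermitian x y = go em
        where
        go : Dec (x ~ y) → W y x ≈ conj (W x y)
        go (no x≁y)  = trans (W-off (x≁y ∘ ~-sym)) (sym (trans (conj-cong (W-off x≁y)) conj0≈0))
        go (yes x~y) = *-cancelʳ (unit (W x y)) (begin
          W y x * value (unit (W x y))            ≈⟨ *-congˡ (value-unit (~⇒spt x~y)) ⟩
          W y x * W x y                           ≈⟨ *-comm (W y x) (W x y) ⟩
          W x y * W y x                           ≈⟨ W-inverse x~y ⟩
          1#                                      ≈⟨ W-conj x~y ⟨
          W x y * conj (W x y)                    ≈⟨ *-comm (W x y) (conj (W x y)) ⟩
          conj (W x y) * W x y                    ≈⟨ *-congˡ (value-unit (~⇒spt x~y)) ⟨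
          conj (W x y) * value (unit (W x y))     ∎)

      W-modulus : ∀ x y → (∣ W x y ∣≈ R.0#) ⊎ (∣ W x y ∣≈ R.1#)
      W-modulus x y = go em
        where
        go : Dec (x ~ y) → (∣ W x y ∣≈ R.0#) ⊎ (∣ W x y ∣≈ R.1#)
        go (no x≁y)  = inj₁ (R.≤-refl , R.sym (R.trans (N-cong (W-off x≁y)) (N-fromℝ R.0#)))
        go (yes x~y) = inj₂ (R.0≤1 , R.trans (R.*-identityˡ R.1#) (R.sym (N-on x~y)))

      isHWeight : IsHWeight W
      isHWeight = record
        { isWeight  = isWeight
        ; hermitian = W-hermitian
        ; modulus   = W-modulus
        ; unital    = W-unital
        }

-- The three bijections.

module Bijections (em : ExcludedMiddle 0ℓ) (F : CompleteOrderedField) (𝔾 : FiniteGroup) where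
  open Weights F 𝔾
  open Complex F
  open Cohomology F
  open ComplexNumbers em F
  open Matrices em F 𝔾
  open Invariant em F 𝔾
  open Equivalences em F 𝔾
  open HEquivalences em F 𝔾
  open FiniteGroup 𝔾 renaming (Carrier to G)
  open Subgroup using (member; ∙-closed)
  open IsHWeight using () renaming (isWeight to H⇒weight)

  ∼⇒≈ : ∀ V W → V ∼ W → classOf V ≈ᴴ² classOf W
  ∼⇒≈ (V , isV) (W , isW) = classOf-cong V isV W isW

  ≈⇒∼ : ∀ V W → classOf V ≈ᴴ² classOf W → V ∼ W
  ≈⇒∼ (V , isV) (W , isW) V≈W = a , γ , idAut , W′≋
    where open Rescaling V isV W isW (≈ᴴ²-sym {classOf (V , isV)} {classOf (W , isW)} V≈W)

  ∼ᴴ⇒∼ : ∀ V W → V ∼ᴴ W → toWeight V ∼ toWeight W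
  ∼ᴴ⇒∼ V W (a , γ , s , W≋ , _) = a , γ , s , W≋

  ≈⇒∼ᴴ : ∀ V W → classOf (toWeight V) ≈ᴴ² classOf (toWeight W) → V ∼ᴴ W
  ≈⇒∼ᴴ (V , isV) (W , isW) V≈W =
    a , γ , idAut , W′≋ , (λ x → ∣∣≈1ℝ (a x) (∣a∣≈1 x)) , (λ g → ∣∣≈1ℝ (γ g) (∣γ∣≈1 g)) , γ-⁻¹
    where
    W≈V = ≈ᴴ²-sym {classOf (toWeight (V , isV))} {classOf (toWeight (W , isW))} V≈W
    open Rescaling V (H⇒weight isV) W (H⇒weight isW) W≈V
    open HRescaling V isV W isW W≈V

    ∣∣≈1ℝ : ∀ u → ∣ u ∣≈1 → ∣ value u ∣≈ R.1#
    ∣∣≈1ℝ u Nu≈1 = R.0≤1 , R.trans (R.*-identityˡ R.1#) (R.sym Nu≈1)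

  module _ (H : Subgroup) (a : FactorSet ⟦ H ⟧) where
    private
      module a = FactorSet a
      P = member H

      row : ∀ {g} → P g → G → ℂˣ
      row {g} p = extend P (λ q → a.α (g , p) q)

    -- Extension by 1 in one argument at a time, from elements with membership proofs to all of `G`;
    -- `α-cong` makes the choice of proof immaterial.
    α : G → G → ℂˣ
    α g h = extend P (λ { (g , p) → row p h }) g

    α-on : ∀ {g h} (p : P g) (q : P h) → a.α (g , p) (h , q) ≈ˣ α g h
    α-on {g} {h} p q = trans (row-on p)
      (extend-on P (λ { (g , p) → row p h })
        (λ p p′ → trans (sym (row-on p)) (trans (a.α-cong ≡.refl ≡.refl) (row-on p′))) p)
      where
      row-on : ∀ {g} (p : P g) → a.α (g , p) (h , q) ≈ˣ row p h
      row-on {g} p = extend-on P (λ q → a.α (g , p) q) (λ _ _ → a.α-cong ≡.refl ≡.refl) q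

    open MultiplicationLaw em 𝔾 H unitGroup using (Cocycle)

    α-cocycle : Cocycle α
    α-cocycle {g} {h} {k} p q r = trans
      (sym (*-cong (α-on p q) (α-on (∙-closed H p q) r)))
      (trans (a.cocycle (g , p) (h , q) (k , r))
        (*-cong (trans (a.α-cong ≡.refl ≡.refl) (α-on p (∙-closed H q r))) (α-on q r)))

  module _ (H : Subgroup) (a : FactorSet ⟦ H ⟧) (α : G → G → ℂˣ)
           (α-on : ∀ {g h} (p : member H g) (q : member H h) → FactorSet.α a (g , p) (h , q) ≈ˣ α g h)
           (nf : Normalisation.NormalForm em F 𝔾 H α) where
    private module N = Normalisation.NormalForm nf
    open Construction em F 𝔾 H

    normalWeight : HWeight
    normalWeight = W N.β N.β-cocycle , isHWeight N.β N.β-cocycle N.∣β∣≈1 N.β-⁻¹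

    classOf-normalWeight : classOf (toWeight normalWeight) ≈ᴴ² (H , a)
    classOf-normalWeight = classOf-≈ N.β N.β-cocycle a N.γ λ (g , p) (h , q) → trans
      (*-congˡ {value (N.β g h)} (inv-cong {FactorSet.α a (g , p) (h , q)} {α g h} (α-on p q)))
      (N.β/α≈δγ p q)

  abstract
    -- As the representative is already an H-weight, this yields surjectivity of all three maps.
    representative : ∀ K → ∃[ V ] classOf (toWeight V) ≈ᴴ² K
    representative (H , a) =
      normalWeight H a (α H a) (α-on H a) (Normalisation.normalForm em F 𝔾 H {α H a} (α-cocycle H a)) ,
      classOf-normalWeight H a (α H a) (α-on H a) (Normalisation.normalForm em F 𝔾 H {α H a} (α-cocycle H a))

  -- The relation is the pullback of `≈ᴴ²` along `classOf`, so transformations need not be inverted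
  -- or composed.
  ∼-isEquivalence : IsEquivalence _∼_
  ∼-isEquivalence = record
    { refl  = λ {V} → ≈⇒∼ V V (≈ᴴ²-refl {classOf V})
    ; sym   = λ {V} {W} p → ≈⇒∼ W V (≈ᴴ²-sym {classOf V} {classOf W} (∼⇒≈ V W p))
    ; trans = λ {U} {V} {W} p q →
        ≈⇒∼ U W (≈ᴴ²-trans {classOf U} {classOf V} {classOf W} (∼⇒≈ U V p) (∼⇒≈ V W q))
    }

  ∼ᴴ⇒≈ : ∀ V W → V ∼ᴴ W → classOf (toWeight V) ≈ᴴ² classOf (toWeight W)
  ∼ᴴ⇒≈ V W p = ∼⇒≈ (toWeight V) (toWeight W) (∼ᴴ⇒∼ V W p)

  ∼ᴴ-isEquivalence : IsEquivalence _∼ᴴ_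
  ∼ᴴ-isEquivalence = record
    { refl  = λ {V} → ≈⇒∼ᴴ V V (≈ᴴ²-refl {classOf (toWeight V)})
    ; sym   = λ {V} {W} p → ≈⇒∼ᴴ W V (≈ᴴ²-sym {classOf (toWeight V)} {classOf (toWeight W)} (∼ᴴ⇒≈ V W p))
    ; trans = λ {U} {V} {W} p q → ≈⇒∼ᴴ U W
        (≈ᴴ²-trans {classOf (toWeight U)} {classOf (toWeight V)} {classOf (toWeight W)} (∼ᴴ⇒≈ U V p) (∼ᴴ⇒≈ V W q))
    }

  ∼-≈-trans : ∀ V W K → V ∼ W → classOf W ≈ᴴ² K → classOf V ≈ᴴ² K
  ∼-≈-trans V W K V∼W W≈K = ≈ᴴ²-trans {classOf V} {classOf W} {K} (∼⇒≈ V W V∼W) W≈K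

  ∼-by-class : ∀ U V W → U ∼ V → classOf V ≈ᴴ² classOf W → U ∼ W
  ∼-by-class U V W U∼V V≈W = ≈⇒∼ U W (∼-≈-trans U V (classOf W) U∼V V≈W)

  toWeight-surjective : ∀ W → ∃[ V ] (∀ {U} → U ∼ᴴ V → toWeight U ∼ W)
  toWeight-surjective W = V , λ {U} U∼V → ∼-by-class (toWeight U) (toWeight V) W (∼ᴴ⇒∼ U V U∼V) V≈W
    where
    V = proj₁ (representative (classOf W))

    V≈W : classOf (toWeight V) ≈ᴴ² classOf W
    V≈W = proj₂ (representative (classOf W))

  toWeight-injective : ∀ {V W} → toWeight V ∼ toWeight W → V ∼ᴴ W
  toWeight-injective {V} {W} p = ≈⇒∼ᴴ V W (∼⇒≈ (toWeight V) (toWeight W) p)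

  toWeight-cong : ∀ {V W} → V ∼ᴴ W → toWeight V ∼ toWeight W
  toWeight-cong {V} {W} = ∼ᴴ⇒∼ V W

  toWeight-isCongruent : IsCongruent _∼ᴴ_ _∼_ toWeight
  toWeight-isCongruent = record
    { cong           = λ {V} {W} → toWeight-cong {V} {W}
    ; isEquivalence₁ = ∼ᴴ-isEquivalence
    ; isEquivalence₂ = ∼-isEquivalence
    }

  toWeight-isBijection : IsBijection _∼ᴴ_ _∼_ toWeight
  toWeight-isBijection = record
    { isInjection = record
      { isCongruent = toWeight-isCongruent
      ; injective   = λ {V} {W} → toWeight-injective {V} {W}
      }
    ; surjective = toWeight-surjective
    }

  classOf-surjective : ∀ K → ∃[ V ] (∀ {U} → U ∼ V → classOf U ≈ᴴ² K)
  classOf-surjective K =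
    let V , V≈K = representative K
    in toWeight V , λ {U} U∼V → ∼-≈-trans U (toWeight V) K U∼V V≈K

  classOf-isBijection : IsBijection _∼_ _≈ᴴ²_ classOf
  classOf-isBijection = record
    { isInjection = record
      { isCongruent = record
        { cong           = λ {V} {W} → ∼⇒≈ V W
        ; isEquivalence₁ = ∼-isEquivalence
        ; isEquivalence₂ = ≈ᴴ²-isEquivalence
        }
      ; injective = λ {V} {W} → ≈⇒∼ V W
      }
    ; surjective = classOf-surjective
    }

  classOf∘toWeight-surjective : ∀ K → ∃[ V ] (∀ {U} → U ∼ᴴ V → classOf (toWeight U) ≈ᴴ² K)
  classOf∘toWeight-surjective K =
    let V , V≈K = representative K
    in V , λ {U} U∼V → ∼-≈-trans (toWeight U) (toWeight V) K (∼ᴴ⇒∼ U V U∼V) V≈K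

  classOf∘toWeight-isBijection : IsBijection _∼ᴴ_ _≈ᴴ²_ (classOf ∘ toWeight)
  classOf∘toWeight-isBijection = record
    { isInjection = record
      { isCongruent = record
        { cong           = λ {V} {W} → ∼ᴴ⇒≈ V W
        ; isEquivalence₁ = ∼ᴴ-isEquivalence
        ; isEquivalence₂ = ≈ᴴ²-isEquivalence
        }
      ; injective = λ {V} {W} → ≈⇒∼ᴴ V W
      }
    ; surjective = classOf∘toWeight-surjective
    }

  classOf-isFactorSetOf : ∀ W → IsFactorSetOf W (classOf W)
  classOf-isFactorSetOf (W , isW) = OfWeight.isFactorSetOf W isW

-- Naturality is expressed by `IsFactorSetOf`, which pins down the subgroup and the values of the
-- factor set on it, and by the last bijection being the composite of the other two.
theorem3p4 : ExcludedMiddle 0ℓ →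
    (R : CompleteOrderedField) (𝔾 : FiniteGroup) →
    let open Weights R 𝔾 in
    IsBijection _∼ᴴ_ _∼_ toWeight ×
    Σ (Weight → ⋃H²) λ f →
    (∀ W → IsFactorSetOf W (f W)) ×
    IsBijection _∼_ _≈ᴴ²_ f ×
    IsBijection _∼ᴴ_ _≈ᴴ²_ (f ∘ toWeight)
theorem3p4 em R 𝔾 =
  toWeight-isBijection , Invariant.classOf em R 𝔾 , classOf-isFactorSetOf ,
  classOf-isBijection , classOf∘toWeight-isBijection
  where open Bijections em R 𝔾
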